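{- Let $n\geq 1$. The map $\hat\Psi:\mathfrak{D}_n\to\mathfrak{D}_n$, $\hat\Psi=\mathrm{sefToPerm}\circ\Psi\circ\mathrm{sefToPerm}^{ -1}$, is an involution satisfying the following properties: (i) the excedance value set is preserved: $\mathrm{EXCv}(\hat\Psi(\sigma))=\mathrm{EXCv}(\sigma)$ for all $\sigma\in\mathfrak{D}_n$; (ii) the set of right-to-left minima is preserved: $\mathrm{RLMv}(\hat\Psi(\sigma))=\mathrm{RLMv}(\sigma)$ for all $\sigma\in\mathfrak{D}_n$; (iii) whenever $\sigma\in\mathfrak{D}_n^*$, $\mathrm{sgn}(\hat\Psi(\sigma))=-\mathrm{sgn}(\sigma)$.
   Context: **Permutations.** $[n]=\{1,\dots,n\}$; $\mathfrak{S}_n$ is the symmetric group on $[n]$; $\mathfrak{D}_n\subseteq\mathfrak{S}_n$ is the set of derangements (permutations without fixed points). $\mathrm{sgn}(\sigma)$ is the usual sign. $\mathrm{EXCv}(\sigma)=\{\sigma(j):j\in[n],\ \sigma(j)>j\}$. $\mathrm{RLMv}(\sigma)=\{\sigma(i): i\in[n],\ \sigma(i)<\sigma(j)\text{ for all }j\in\{i+1,\dots,n\}\}$. **Subexcedant functions.** A subexcedant function on $[n]$ is a map $f:[n]\to[n]$ with $1\le f(i)\le i$ for all $i$; it is written as the word $f(1)f(2)\dots f(n)$. $\mathcal{F}_n$ is the set of these, and $\mathrm{IM}(f)=\{f(i):i\in[n]\}$. The map $\mathrm{sefToPerm}:\mathcal{F}_n\to\mathfrak{S}_n$, $\mathrm{sefToPerm}(f)=(n\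 f(n))\cdots(2\ f(2))(1\ f(1))$ (product of transpositions, rightmost factor applied first, $(i\ i)$ meaning the identity) is a bijection; put $f_\sigma=\mathrm{sefToPerm}^{ -1}(\sigma)$. Let $\mathcal{DF}_n=\{f_\sigma:\sigma\in\mathfrak{D}_n\}$. A subexcedant function $f$ on $[n]$ is *matchless* if $f=1\,1\,2\,3\cdots(k{ - }1)\,k\,k\cdots k$ for some $1\le k\le n-1$, i.e. $f(1)=1$ and $f(j)=\min(j-1,k)$ for $2\le j\le n$. $\mathfrak{D}_n^*$ is the set of derangements $\sigma$ such that $f_\sigma$ is not matchless. **The map $\Psi:\mathcal{DF}_n\to\mathcal{DF}_n$.** If $f\in\mathcal{DF}_n$ is matchless, $\Psi(f)=f$. Otherwise write $\mathrm{IM}(f)=\{\mathbf{m}_1<\mathbf{m}_2<\dots<\mathbf{m}_\ell\}$ (so $\mathbf{m}_1=1$, $\ell\ge2$). For $i\in\{2,\dots,\ell\}$, $\mathrm{fix}_i(f)$ is obtained from $f$ by changing its value at $\mathbf{m}_i$ to $\mathbf{m}_i$, and $\mathrm{unfix}_i(f)$ by changing its value at $\mathbf{m}_i$ to $\mathbf{m}_{i-1}$; all other values are unchanged. Say that $\circledast_i$ holds for $f$ if $f(\mathbf{m}_i)<\mathbf{m}_i<\mathbf{m}_\ell$, $f^{ -1}(1)=\{1,2\}$, and $\{\mathbf{m}_i+1\}\subsetneq f^{ -1}(\mathbf{m}_i)$. Let $i\in\{2,\dots,\ell\}$ be the smallest index satisfying one of the following (mutually exclusive) cases; such an $i$ exists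 whenever $f\in\mathcal{DF}_n$ is not matchless. Then: - Case $\heartsuit_i$: $f(\mathbf{m}_i)=\mathbf{m}_i$; then $\Psi(f)=\mathrm{unfix}_i(f)$. - Case $\spadesuit_i$: $f(\mathbf{m}_i)<\mathbf{m}_i$ and $|f^{ -1}(1)|\ge3$; then $\Psi(f)=\mathrm{fix}_i(f)$. - Case $\diamondsuit_i$: $\circledast_i$ holds and $f(\mathbf{m}_{i+1})=\mathbf{m}_{i+1}$; then $\Psi(f)=\mathrm{unfix}_{i+1}(f)$. - Case $\clubsuit_i$: $\circledast_i$ holds and $f(\mathbf{m}_{i+1})<\mathbf{m}_{i+1}$; then $\Psi(f)=\mathrm{fix}_{i+1}(f)$. -}

module Defs where

open import Data.Fin.Base using (Fin; zero; suc; toℕ; fromℕ<; inject₁; pred; _≤_; _<_)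
open import Data.Fin.Permutation
  using (Permutation′; _⟨$⟩ʳ_; _⟨$⟩ˡ_; _≈_; _∘ₚ_; transpose; inverseˡ; inverseʳ)
open import Data.Fin.Permutation.Components using (transpose-inverse)
  renaming (transpose to swap)
open import Data.Fin.Permutation.Transposition.List using (eval)
open import Data.Fin.Properties
  using (_≟_; _≤?_; _<?_; any?; all?; toℕ-fromℕ<; toℕ<n; ≤-refl; <⇒≢; <-cmp)
open import Data.Fin.Subset using (Subset; ⁅_⁆; _∪_; _⊂_; ∣_∣)
open import Data.Fin.Subset.Properties using (_⊂?_)
open import Data.Bool.Properties using () renaming (_≟_ to _≟ᵇ_)
open import Data.Integer.Base using (ℤ; -1ℤ) renaming (_^_ to _^ᶻ_)
open import Data.List.Base
  using (List; []; _∷_; _∷ʳ_; _++_; map; filter; length; lookup; allFin; cartesianProduct)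
open import Data.List.Membership.Propositional using (_∈_)
open import Data.List.Membership.Propositional.Properties using (∈-allFin; ∈-++⁺ʳ)
open import Data.List.Relation.Unary.All as All using (All; []; _∷_)
open import Data.List.Relation.Unary.All.Properties using (∷ʳ⁺)
open import Data.List.Relation.Unary.AllPairs using (AllPairs; []; _∷_)
import Data.List.Relation.Unary.AllPairs.Properties as AllPairs
open import Data.List.Relation.Unary.Any using (here; there)
open import Data.List.Reverse using (Reverse; reverseView; []; _∶_∶ʳ_)
open import Data.Nat.Base as ℕ using (ℕ; _∸_; _⊓_)
import Data.Nat.Properties as ℕ
open import Data.Product.Base using (∃; ∃₂; _×_; _,_; proj₁; proj₂)
open import Data.Sum.Base using (_⊎_; inj₁; inj₂)
open import Data.Vec.Base as Vec using (Vec; _[_]≔_; tabulate)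
open import Data.Vec.Properties
  using (≡-dec; lookup∘update; lookup∘update′; lookup∘tabulate; tabulate∘lookup; tabulate-cong)
open import Function.Base using (id; _∘_)
open import Relation.Binary.Definitions using (tri<; tri≈; tri>)
open import Relation.Binary.PropositionalEquality
  using (_≡_; _≢_; refl; sym; trans; cong; cong₂; subst; module ≡-Reasoning)
open import Relation.Nullary
  using (¬_; Dec; yes; no; does; recompute; ¬?; _×-dec_; _⊎-dec_; _→-dec_; contradiction)
open import Relation.Unary using (Pred)

private
  variable
    n : ℕ

-- The set [n] is Fin n; the inhabitant i stands for the number ⟦ i ⟧.

⟦_⟧ : Fin n → ℕ
⟦ i ⟧ = ℕ.suc (toℕ i)

------------------------------------------------------------------------
-- Permutations

IsDerangement : Permutation′ n → Set
IsDerangement σ = ∀ i → σ ⟨$⟩ʳ i ≢ i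

inversions : Permutation′ n → List (Fin n × Fin n)
inversions {n} σ =
  filter (λ (i , j) → (i <? j) ×-dec (σ ⟨$⟩ʳ j <? σ ⟨$⟩ʳ i))
         (cartesianProduct (allFin n) (allFin n))

sgn : Permutation′ n → ℤ
sgn σ = -1ℤ ^ᶻ length (inversions σ)

EXCv : Permutation′ n → Pred (Fin n) _
EXCv σ v = ∃ λ j → σ ⟨$⟩ʳ j ≡ v × j < σ ⟨$⟩ʳ j

RLMv : Permutation′ n → Pred (Fin n) _
RLMv σ v = ∃ λ i → σ ⟨$⟩ʳ i ≡ v × (∀ j → i < j → σ ⟨$⟩ʳ i < σ ⟨$⟩ʳ j)

------------------------------------------------------------------------
-- Subexcedant functions

-- The bound is irrelevant, so that _≡_ on SEF n is equality of words.

record SEF (n : ℕ) : Set where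
  constructor sef
  field
    word         : Vec (Fin n) n
    .subexcedant : ∀ i → Vec.lookup word i ≤ i

  infixl 20 _at_
  _at_ : Fin n → Fin n
  _at_ = Vec.lookup word

open SEF public using (word; _at_)

at-≤ : (f : SEF n) → ∀ i → f at i ≤ i
at-≤ (sef w b) i = recompute (Vec.lookup w i ≤? i) (b i)

SEF-ext : {f g : SEF n} → (∀ i → f at i ≡ g at i) → f ≡ g
SEF-ext {f = f} {g} eq = go words
  where
  words : word f ≡ word g
  words = trans (sym (tabulate∘lookup (word f)))
            (trans (tabulate-cong eq) (tabulate∘lookup (word g)))

  go : word f ≡ word g → f ≡ g
  go refl = refl

_[_↦_]⟨_⟩ : (f : SEF n) (i v : Fin n) → v ≤ i → SEF n
f [ i ↦ v ]⟨ v≤i ⟩ = sef (word f [ i ]≔ v) bound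
  where
  bound : ∀ j → Vec.lookup (word f [ i ]≔ v) j ≤ j
  bound j with j ≟ i
  ... | yes refl = subst (_≤ i) (sym (lookup∘update i (word f) v)) v≤i
  ... | no j≢i   = subst (_≤ j) (sym (lookup∘update′ j≢i (word f) v)) (at-≤ f j)

-- eval applies the head of the list first, and transpose i i is the identity.

sefToPerm : SEF n → Permutation′ n
sefToPerm {n} f = eval (map (λ i → i , f at i) (allFin n))

------------------------------------------------------------------------
-- sefToPerm is a bijection

private
  swap-self : (i x : Fin n) → swap i i x ≡ x
  swap-self i x with x ≟ i
  ... | yes x≡i = sym x≡i
  ... | no  x≢i with x ≟ i
  ...   | yes x≡i = sym x≡i
  ...   | no  _   = refl

  swap-left : (i j : Fin n) → swap i j i ≡ j
  swap-left i j with i ≟ i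
  ... | yes _  = refl
  ... | no i≢i = contradiction refl i≢i

  swap-other : {i j x : Fin n} → x ≢ i → x ≢ j → swap i j x ≡ x
  swap-other {i = i} {j} {x} x≢i x≢j with x ≟ i
  ... | yes x≡i = contradiction x≡i x≢i
  ... | no  _ with x ≟ j
  ...   | yes x≡j = contradiction x≡j x≢j
  ...   | no  _   = refl

  transpositions : SEF n → List (Fin n) → List (Fin n × Fin n)
  transpositions f = map (λ i → i , f at i)

  _∙_ : SEF n × List (Fin n) → Fin n → Fin n
  (f , is) ∙ x = eval (transpositions f is) ⟨$⟩ʳ x

  allFin-sorted : ∀ n → AllPairs _<_ (allFin n)
  allFin-sorted n = AllPairs.tabulate⁺-< id

  ∙-trivial : (f : SEF n) {is : List (Fin n)} → All (λ i → f at i ≡ i) is →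
              ∀ x → (f , is) ∙ x ≡ x
  ∙-trivial f []                          x = refl
  ∙-trivial f (_∷_ {x = i} {xs = is} p ps) x = begin
    (f , is) ∙ swap i (f at i) x ≡⟨ ∙-trivial f ps _ ⟩
    swap i (f at i) x            ≡⟨ cong (λ j → swap i j x) p ⟩
    swap i i x                   ≡⟨ swap-self i x ⟩
    x                            ∎
    where open ≡-Reasoning

  ∙-extend : (f g : SEF n) (c : Fin n) →
             (∀ i → i ≢ c → g at i ≡ f at i) → (∀ i → c ≤ i → f at i ≡ i) →
             ∀ {is} → AllPairs _<_ is → c ∈ is → ∀ x →
             (g , is) ∙ x ≡ swap c (g at c) ((f , is) ∙ x)
  ∙-extend f g c g≗f f-id {i ∷ is} (c<is ∷ _) (here refl) x = begin
    (g , is) ∙ swap c (g at c) x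
      ≡⟨ ∙-trivial g (All.map (λ {j} c<j → trans (g≗f j (<⇒≢ c<j ∘ sym)) (f-id j (ℕ.<⇒≤ c<j))) c<is) _ ⟩
    swap c (g at c) x
      ≡⟨ cong (swap c (g at c)) (∙-trivial f (f-id c ≤-refl ∷ All.map (λ {j} c<j → f-id j (ℕ.<⇒≤ c<j)) c<is) x) ⟨
    swap c (g at c) ((f , c ∷ is) ∙ x) ∎
    where open ≡-Reasoning
  ∙-extend f g c g≗f f-id {i ∷ is} (i<is ∷ sorted) (there c∈is) x = begin
    (g , is) ∙ swap i (g at i) x
      ≡⟨ cong (λ j → (g , is) ∙ swap i j x) (g≗f i (<⇒≢ (All.lookup i<is c∈is))) ⟩
    (g , is) ∙ swap i (f at i) x
      ≡⟨ ∙-extend f g c g≗f f-id sorted c∈is _ ⟩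
    swap c (g at c) ((f , i ∷ is) ∙ x) ∎
    where open ≡-Reasoning

  identity : SEF n
  identity = sef (tabulate id) (λ i → ℕ.≤-reflexive (cong toℕ (lookup∘tabulate id i)))

  module _ (σ : Permutation′ n) (c : Fin n) (σ-id : ∀ i → c < i → σ ⟨$⟩ʳ i ≡ i) where

    top-≤ : σ ⟨$⟩ʳ c ≤ c
    top-≤ with σ ⟨$⟩ʳ c ≤? c
    ... | yes p = p
    ... | no ¬p = contradiction (ℕ.≤-reflexive (cong toℕ σc≡c)) ¬p
      where
      σc≡c : σ ⟨$⟩ʳ c ≡ c
      σc≡c = trans (sym (inverseˡ σ))
               (trans (cong (σ ⟨$⟩ˡ_) (σ-id _ (ℕ.≰⇒> ¬p))) (inverseˡ σ))

    peel : Permutation′ n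
    peel = σ ∘ₚ transpose (σ ⟨$⟩ʳ c) c

    peel-id : ∀ i → c ≤ i → peel ⟨$⟩ʳ i ≡ i
    peel-id i c≤i with <-cmp c i
    ... | tri> _ _ i<c = contradiction c≤i (ℕ.<⇒≱ i<c)
    ... | tri≈ _ refl _ = swap-left (σ ⟨$⟩ʳ c) c
    ... | tri< c<i c≢i _ = trans (cong (swap (σ ⟨$⟩ʳ c) c) (σ-id i c<i))
            (swap-other (λ i≡σc → <⇒≢ (ℕ.≤-<-trans top-≤ c<i) (sym i≡σc)) (c≢i ∘ sym))

    unpeel : (∃ λ f → (∀ i → c ≤ i → f at i ≡ i) × sefToPerm f ≈ peel) →
             ∃ λ g → (∀ i → c < i → g at i ≡ i) × sefToPerm g ≈ σ
    unpeel (f , f-id , f≈) = g , g-id , g≈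
      where
      g = f [ c ↦ σ ⟨$⟩ʳ c ]⟨ top-≤ ⟩

      g≗f : ∀ i → i ≢ c → g at i ≡ f at i
      g≗f i i≢c = lookup∘update′ i≢c (word f) _

      g-id : ∀ i → c < i → g at i ≡ i
      g-id i c<i = trans (g≗f i (<⇒≢ c<i ∘ sym)) (f-id i (ℕ.<⇒≤ c<i))

      g≈ : sefToPerm g ≈ σ
      g≈ x = begin
        sefToPerm g ⟨$⟩ʳ x
          ≡⟨ ∙-extend f g c g≗f f-id (allFin-sorted _) (∈-allFin c) x ⟩
        swap c (g at c) (sefToPerm f ⟨$⟩ʳ x)
          ≡⟨ cong₂ (swap c) (lookup∘update c (word f) _) (f≈ x) ⟩
        swap c (σ ⟨$⟩ʳ c) (swap (σ ⟨$⟩ʳ c) c (σ ⟨$⟩ʳ x))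
          ≡⟨ transpose-inverse c (σ ⟨$⟩ʳ c) ⟩
        σ ⟨$⟩ʳ x ∎
        where open ≡-Reasoning

  surjective-from : ∀ k (σ : Permutation′ n) → k ℕ.≤ n →
    (∀ i → k ℕ.≤ toℕ i → σ ⟨$⟩ʳ i ≡ i) →
    ∃ λ f → (∀ i → k ℕ.≤ toℕ i → f at i ≡ i) × sefToPerm f ≈ σ
  surjective-from ℕ.zero σ _ σ-id =
    identity , (λ i _ → lookup∘tabulate id i) ,
    λ x → trans (∙-trivial identity {allFin _} (All.tabulate (λ {i} _ → lookup∘tabulate id i)) x)
                (sym (σ-id x ℕ.z≤n))
  surjective-from {n} (ℕ.suc k) σ k<n σ-id = step (fromℕ< k<n) (toℕ-fromℕ< k<n) σ-id
    where
    step : ∀ (c : Fin n) → toℕ c ≡ k → (∀ i → ℕ.suc k ℕ.≤ toℕ i → σ ⟨$⟩ʳ i ≡ i) →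
           ∃ λ f → (∀ i → ℕ.suc k ℕ.≤ toℕ i → f at i ≡ i) × sefToPerm f ≈ σ
    step c refl σ-id =
      unpeel σ c σ-id (surjective-from k (peel σ c σ-id) (ℕ.<⇒≤ k<n) (peel-id σ c σ-id))

  ∙-∷ʳ : (f : SEF n) (is : List (Fin n)) (y : Fin n) → ∀ x →
         (f , is ∷ʳ y) ∙ x ≡ swap y (f at y) ((f , is) ∙ x)
  ∙-∷ʳ f []       y x = refl
  ∙-∷ʳ f (i ∷ is) y x = ∙-∷ʳ f is y (swap i (f at i) x)

  ∙-above : (f : SEF n) {is : List (Fin n)} {y : Fin n} → All (_< y) is → (f , is) ∙ y ≡ y
  ∙-above f []                          = refl
  ∙-above f {i ∷ is} {y} (i<y ∷ is<y) = trans
    (cong ((f , is) ∙_) (swap-other (<⇒≢ i<y ∘ sym)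
      (<⇒≢ (ℕ.≤-<-trans (at-≤ f i) i<y) ∘ sym)))
    (∙-above f is<y)

  ∷ʳ-sorted⁻ : ∀ (is : List (Fin n)) {y} → AllPairs _<_ (is ∷ʳ y) → AllPairs _<_ is × All (_< y) is
  ∷ʳ-sorted⁻ []       _             = [] , []
  ∷ʳ-sorted⁻ (i ∷ is) (i< ∷ sorted) with ps , qs ← ∷ʳ-sorted⁻ is sorted =
    (All.tabulate (λ j∈is → All.lookup i< (∈-++ˡ j∈is)) ∷ ps) ,
    (All.lookup i< (∈-++⁺ʳ is (here refl)) ∷ qs)
    where
    ∈-++ˡ : ∀ {j js ks} → j ∈ js → j ∈ (js ++ ks)
    ∈-++ˡ (here p)  = here p
    ∈-++ˡ (there p) = there (∈-++ˡ p)

  injective-on : (f g : SEF n) {is : List (Fin n)} → Reverse is → AllPairs _<_ is →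
                 (∀ x → (f , is) ∙ x ≡ (g , is) ∙ x) → All (λ i → f at i ≡ g at i) is
  injective-on f g [] _ _ = []
  injective-on f g (is ∶ rs ∶ʳ y) sorted eq
    with ps , qs ← ∷ʳ-sorted⁻ is sorted
    = ∷ʳ⁺ (injective-on f g rs ps below) last
    where
    open ≡-Reasoning

    last-value : ∀ h → (h , is ∷ʳ y) ∙ y ≡ h at y
    last-value h = begin
      (h , is ∷ʳ y) ∙ y               ≡⟨ ∙-∷ʳ h is y y ⟩
      swap y (h at y) ((h , is) ∙ y)  ≡⟨ cong (swap y (h at y)) (∙-above h qs) ⟩
      swap y (h at y) y               ≡⟨ swap-left y (h at y) ⟩
      h at y                          ∎

    last : f at y ≡ g at y
    last = trans (sym (last-value f)) (trans (eq y) (last-value g))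

    below : ∀ x → (f , is) ∙ x ≡ (g , is) ∙ x
    below x = begin
      (f , is) ∙ x
        ≡⟨ transpose-inverse (f at y) y ⟨
      swap (f at y) y (swap y (f at y) ((f , is) ∙ x))
        ≡⟨ cong (swap (f at y) y) (trans (sym (∙-∷ʳ f is y x)) (trans (eq x) (∙-∷ʳ g is y x))) ⟩
      swap (f at y) y (swap y (g at y) ((g , is) ∙ x))
        ≡⟨ cong (λ v → swap v y (swap y (g at y) ((g , is) ∙ x))) last ⟩
      swap (g at y) y (swap y (g at y) ((g , is) ∙ x))
        ≡⟨ transpose-inverse (g at y) y ⟩
      (g , is) ∙ x ∎

sefToPerm-surjective : (σ : Permutation′ n) → ∃ λ f → sefToPerm f ≈ σ
sefToPerm-surjective {n} σ
  with f , _ , f≈σ ← surjective-from n σ ℕ.≤-refl (λ i n≤i → contradiction n≤i (ℕ.<⇒≱ (toℕ<n i)))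
  = f , f≈σ

sefToPerm-injective : {f g : SEF n} → sefToPerm f ≈ sefToPerm g → f ≡ g
sefToPerm-injective {n} {f} {g} eq = SEF-ext λ i →
  All.lookup (injective-on f g (reverseView (allFin n)) (allFin-sorted n) eq) (∈-allFin i)

sefToPerm⁻¹ : Permutation′ n → SEF n
sefToPerm⁻¹ σ = proj₁ (sefToPerm-surjective σ)

sefToPerm∘sefToPerm⁻¹ : (σ : Permutation′ n) → sefToPerm (sefToPerm⁻¹ σ) ≈ σ
sefToPerm∘sefToPerm⁻¹ σ = proj₂ (sefToPerm-surjective σ)

sefToPerm⁻¹∘sefToPerm : (f : SEF n) → sefToPerm⁻¹ (sefToPerm f) ≡ f
sefToPerm⁻¹∘sefToPerm f = sefToPerm-injective (sefToPerm∘sefToPerm⁻¹ (sefToPerm f))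

sefToPerm⁻¹-cong : {σ τ : Permutation′ n} → σ ≈ τ → sefToPerm⁻¹ σ ≡ sefToPerm⁻¹ τ
sefToPerm⁻¹-cong {σ = σ} {τ} σ≈τ = sefToPerm-injective λ i →
  trans (sefToPerm∘sefToPerm⁻¹ σ i) (trans (σ≈τ i) (sym (sefToPerm∘sefToPerm⁻¹ τ i)))

------------------------------------------------------------------------
-- Matchless subexcedant functions

-- The parameter k ranges over [n] with ⟦ k ⟧ < n, i.e. over 1, …, n - 1.

Matchless : SEF n → Set
Matchless {n} f = ∃ λ (k : Fin n) → ⟦ k ⟧ ℕ.< n ×
  (∀ j → (⟦ j ⟧ ≡ 1 → ⟦ f at j ⟧ ≡ 1) ×
         (2 ℕ.≤ ⟦ j ⟧ → ⟦ f at j ⟧ ≡ (⟦ j ⟧ ∸ 1) ⊓ ⟦ k ⟧))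

matchless? : (f : SEF n) → Dec (Matchless f)
matchless? {n} f = any? λ k → (⟦ k ⟧ ℕ.<? n) ×-dec all? λ j →
  ((⟦ j ⟧ ℕ.≟ 1) →-dec (⟦ f at j ⟧ ℕ.≟ 1)) ×-dec
  ((2 ℕ.≤? ⟦ j ⟧) →-dec (⟦ f at j ⟧ ℕ.≟ (⟦ j ⟧ ∸ 1) ⊓ ⟦ k ⟧))

IsDerangement* : Permutation′ n → Set
IsDerangement* σ = IsDerangement σ × ¬ Matchless (sefToPerm⁻¹ σ)

------------------------------------------------------------------------
-- The map Ψ

infix 25 _⁻¹_

_⁻¹_ : SEF n → ℕ → Subset n
f ⁻¹ v = tabulate λ j → does (⟦ f at j ⟧ ℕ.≟ v)

-- Indices i ∈ Fin ℓ are likewise read as ⟦ i ⟧ ∈ {1, …, ℓ}.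

module _ {n : ℕ} (f : SEF n) where

  -- The image in increasing order.
  IM : List (Fin n)
  IM = filter (λ v → any? λ j → f at j ≟ v) (allFin n)

  ℓ : ℕ
  ℓ = length IM

  𝐦 : Fin ℓ → Fin n
  𝐦 = lookup IM

  𝐦-pred-≤ : ∀ i → 𝐦 (pred i) ≤ 𝐦 i
  𝐦-pred-≤ = go (AllPairs.filter⁺ _ (allFin-sorted n))
    where
    go : ∀ {is : List (Fin n)} → AllPairs _<_ is → ∀ i → lookup is (pred i) ≤ lookup is i
    go {_ ∷ _}     _             zero          = ≤-refl
    go {_ ∷ _ ∷ _} ((i<j ∷ _) ∷ _) (suc zero)    = ℕ.<⇒≤ i<j
    go {_ ∷ _ ∷ _} (_ ∷ sorted)    (suc (suc i)) = go sorted (suc i)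

  fix : Fin ℓ → SEF n
  fix i = f [ 𝐦 i ↦ 𝐦 i ]⟨ ≤-refl ⟩

  unfix : Fin ℓ → SEF n
  unfix i = f [ 𝐦 i ↦ 𝐦 (pred i) ]⟨ 𝐦-pred-≤ i ⟩

  -- The numbers 1, 2, mᵢ + 1 and the indices ℓ, i + 1 are named by the
  -- inhabitants of Fin n and Fin ℓ with these values; whenever mᵢ < m_ℓ with
  -- ⟦ i ⟧ ≥ 2 these all exist, so the quantifiers add no condition.
  ⊛ : Fin ℓ → Set
  ⊛ i = f at 𝐦 i < 𝐦 i
      × (∃ λ last → ⟦ last ⟧ ≡ ℓ × 𝐦 i < 𝐦 last)
      × (∃₂ λ one two → ⟦ one ⟧ ≡ 1 × ⟦ two ⟧ ≡ 2 × f ⁻¹ 1 ≡ ⁅ one ⁆ ∪ ⁅ two ⁆)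
      × (∃ λ next → ⟦ next ⟧ ≡ ⟦ 𝐦 i ⟧ ℕ.+ 1 × ⁅ next ⁆ ⊂ f ⁻¹ ⟦ 𝐦 i ⟧)

  ♥ ♠ ◇ ♣ : Fin ℓ → Set
  ♥ i = f at 𝐦 i ≡ 𝐦 i
  ♠ i = f at 𝐦 i < 𝐦 i × ∣ f ⁻¹ 1 ∣ ℕ.≥ 3
  ◇ i = ⊛ i × ∃ λ i⁺ → ⟦ i⁺ ⟧ ≡ ⟦ i ⟧ ℕ.+ 1 × f at 𝐦 i⁺ ≡ 𝐦 i⁺
  ♣ i = ⊛ i × ∃ λ i⁺ → ⟦ i⁺ ⟧ ≡ ⟦ i ⟧ ℕ.+ 1 × f at 𝐦 i⁺ < 𝐦 i⁺

  Case : Fin ℓ → Set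
  Case i = ♥ i ⊎ ♠ i ⊎ ◇ i ⊎ ♣ i

  LeastCase : Fin ℓ → Set
  LeastCase i = (2 ℕ.≤ ⟦ i ⟧ × Case i) × (∀ j → j < i → ¬ (2 ℕ.≤ ⟦ j ⟧ × Case j))

  case? : ∀ i → Dec (Case i)
  case? i = ♥? ⊎-dec ♠? ⊎-dec ◇? ⊎-dec ♣?
    where
    ⊛? : Dec (⊛ i)
    ⊛? = (f at 𝐦 i <? 𝐦 i)
      ×-dec (any? λ last → (⟦ last ⟧ ℕ.≟ ℓ) ×-dec (𝐦 i <? 𝐦 last))
      ×-dec (any? λ one → any? λ two → (⟦ one ⟧ ℕ.≟ 1) ×-dec (⟦ two ⟧ ℕ.≟ 2)
               ×-dec ≡-dec _≟ᵇ_ (f ⁻¹ 1) (⁅ one ⁆ ∪ ⁅ two ⁆))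
      ×-dec (any? λ next → (⟦ next ⟧ ℕ.≟ ⟦ 𝐦 i ⟧ ℕ.+ 1) ×-dec (⁅ next ⁆ ⊂? f ⁻¹ ⟦ 𝐦 i ⟧))

    ♥? : Dec (♥ i)
    ♥? = f at 𝐦 i ≟ 𝐦 i

    ♠? : Dec (♠ i)
    ♠? = (f at 𝐦 i <? 𝐦 i) ×-dec (3 ℕ.≤? ∣ f ⁻¹ 1 ∣)

    ◇? : Dec (◇ i)
    ◇? = ⊛? ×-dec any? λ i⁺ → (⟦ i⁺ ⟧ ℕ.≟ ⟦ i ⟧ ℕ.+ 1) ×-dec (f at 𝐦 i⁺ ≟ 𝐦 i⁺)

    ♣? : Dec (♣ i)
    ♣? = ⊛? ×-dec any? λ i⁺ → (⟦ i⁺ ⟧ ℕ.≟ ⟦ i ⟧ ℕ.+ 1) ×-dec (f at 𝐦 i⁺ <? 𝐦 i⁺)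

  leastCase? : ∀ i → Dec (LeastCase i)
  leastCase? i = eligible? i ×-dec all? λ j → (j <? i) →-dec ¬? (eligible? j)
    where
    eligible? : ∀ j → Dec (2 ℕ.≤ ⟦ j ⟧ × Case j)
    eligible? j = (2 ℕ.≤? ⟦ j ⟧) ×-dec case? j

  act : ∀ i → Case i → SEF n
  act i (inj₁ _)                             = unfix i
  act i (inj₂ (inj₁ _))                      = fix i
  act i (inj₂ (inj₂ (inj₁ (_ , i⁺ , _))))    = unfix i⁺
  act i (inj₂ (inj₂ (inj₂ (_ , i⁺ , _))))    = fix i⁺

-- Ψ is defined on all of SEF n. The last clause is never reached when f comes
-- from a derangement; it only makes Ψ total on the remaining words.

Ψ : SEF n → SEF n
Ψ f with matchless? f
... | yes _ = f
... | no  _ with any? (leastCase? f)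
...   | yes (i , (_ , c) , _) = act f i c
...   | no  _                 = f

Ψ̂ : Permutation′ n → Permutation′ n
Ψ̂ σ = sefToPerm (Ψ (sefToPerm⁻¹ σ))

Ψ̂-cong : {σ τ : Permutation′ n} → σ ≈ τ → Ψ̂ σ ≈ Ψ̂ τ
Ψ̂-cong σ≈τ i = cong (λ f → sefToPerm (Ψ f) ⟨$⟩ʳ i) (sefToPerm⁻¹-cong σ≈τ)

{-# OPTIONS --safe #-}

-- Write σ for sefToPerm f. Following a single index through the product of transpositions
-- shows that either σ(x) = f(x), when x is the last occurrence of f(x) in the word, or σ(x) > x
-- is outside IM(f). Hence EXCv(σ) is the complement of IM(f); v ∈ RLMv(σ) iff v ∈ IM(f) and
-- every smaller letter is followed by a v; and σ is a derangement iff every fixed letter x of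
-- the word occurs again. Every case of Ψ toggles the letter at one place c ∈ IM(f) between c
-- and its predecessor p in IM(f), which adds or removes one nontrivial transposition, so the
-- sign changes. The place is singled out by a condition (Pivot) that does not depend on which
-- of the two letters is present and that determines p and c, so Ψ undoes itself; the same
-- condition guarantees that p and c both occur elsewhere in the word, which preserves all
-- three descriptions.

module Submission where

open import Defs
open import Data.Bool.Base using (true)
open import Data.Empty using (⊥)
open import Data.Fin.Base
  using (Fin; zero; suc; toℕ; fromℕ; fromℕ<; pred; _≤_; _<_; _>_)
open import Data.Fin.Induction using (<-wellFounded; >-wellFounded)
open import Data.Fin.Permutation
  using (Permutation′; _≈_; _⟨$⟩ʳ_; _⟨$⟩ˡ_; _∘ₚ_; transpose; inverseˡ; inverseʳ)
open import Data.Fin.Permutation.Components using (transpose-inverse)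
  renaming (transpose to swap)
open import Data.Fin.Permutation.Transposition.List using (eval)
open import Data.Fin.Properties
  using (_≟_; _<?_; any?; <⇒≢; <-cmp; toℕ-injective; toℕ<n; toℕ-fromℕ; toℕ-fromℕ<; toℕ-inject₁)
open import Data.Fin.Subset
  using (Subset; ⁅_⁆; _∪_; ∣_∣; inside; outside) renaming (_∈_ to _∈ₛ_)
open import Data.Fin.Subset.Properties
  using (_∈?_; x∈⁅x⁆; x∈⁅y⁆⇒x≡y; x≢y⇒x∉⁅y⁆; x∈p∪q⁺; x∈p∪q⁻; ∣⁅x⁆∣≡1; ⊆-antisym;
         p⊆q⇒∣p∣≤∣q∣; x∈p⇒∣p-x∣<∣p∣; x∈p∧x≢y⇒x∈p-y)
open import Data.Integer.Base using (-_; -1ℤ) renaming (_^_ to _^ᶻ_)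
open import Data.Integer.Properties using (-1*i≡-i; neg-involutive)
open import Data.List.Base
  using (List; []; _∷_; map; filter; length; lookup; allFin; cartesianProduct)
open import Data.List.Membership.Propositional using (_∈_)
open import Data.List.Membership.Propositional.Properties
  using (∈-allFin; ∈-cartesianProduct⁺; ∈-lookup; ∈-filter⁺; ∈-filter⁻)
open import Data.List.Relation.Unary.All as All using (All; []; _∷_)
open import Data.List.Relation.Unary.AllPairs using (AllPairs; []; _∷_)
import Data.List.Relation.Unary.AllPairs.Properties as AllPairs
open import Data.List.Relation.Unary.Any as Any using (Any; here; there)
open import Data.List.Relation.Unary.Any.Properties using (lookup-index)
open import Data.List.Relation.Unary.Unique.Propositional using (Unique)
open import Data.List.Relation.Unary.Unique.Propositional.Properties
  using (allFin⁺; cartesianProduct⁺)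
open import Data.Nat.Base as ℕ using (ℕ; _≥_; _⊓_; _∸_; s≤s; z≤n)
import Data.Nat.Properties as ℕ
open import Data.Product.Base using (_×_; ∃; ∃₂; _,_; proj₁; proj₂)
open import Data.Sum.Base using (_⊎_; inj₁; inj₂; [_,_]′)
open import Data.Vec.Base using ([]; _∷_)
open import Data.Vec.Properties
  using (lookup⇒[]=; []=⇒lookup; lookup∘tabulate; lookup∘update; lookup∘update′)
open import Function.Base using (id; _∘_)
open import Induction.WellFounded using (Acc; acc)
open import Level using (0ℓ)
open import Relation.Binary.Definitions using (tri<; tri≈; tri>)
open import Relation.Binary.PropositionalEquality
  using (_≡_; _≢_; refl; sym; trans; cong; cong₂; subst; subst₂; module ≡-Reasoning)
open import Relation.Nullary using (¬_; Dec; yes; no; does; ¬?; _×-dec_; contradiction)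
open import Relation.Nullary.Decidable using (dec-true)
open import Relation.Unary using (_≐_; Pred; Decidable)

private
  variable
    n : ℕ

-- Elementary facts about transpositions.

swap-left : (a b : Fin n) → swap a b a ≡ b
swap-left a b with a ≟ a
... | yes _  = refl
... | no a≢a = contradiction refl a≢a

swap-right : (a b : Fin n) → swap a b b ≡ a
swap-right a b with b ≟ a
... | yes b≡a = b≡a
... | no  _ with b ≟ b
...   | yes _  = refl
...   | no b≢b = contradiction refl b≢b

swap-other : {a b x : Fin n} → x ≢ a → x ≢ b → swap a b x ≡ x
swap-other {a = a} {b} {x} x≢a x≢b with x ≟ a
... | yes x≡a = contradiction x≡a x≢a
... | no  _ with x ≟ b
...   | yes x≡b = contradiction x≡b x≢b
...   | no  _   = refl

data SwapView (a b x : Fin n) : Set where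
  left  : x ≡ a → SwapView a b x
  right : x ≢ a → x ≡ b → SwapView a b x
  other : x ≢ a → x ≢ b → SwapView a b x

swapView : (a b x : Fin n) → SwapView a b x
swapView a b x with x ≟ a
... | yes x≡a = left x≡a
... | no  x≢a with x ≟ b
...   | yes x≡b = right x≢a x≡b
...   | no  x≢b = other x≢a x≢b

swap-trivial : (a x : Fin n) → swap a a x ≡ x
swap-trivial a x with swapView a a x
... | left refl     = swap-left x x
... | right _ refl  = swap-left x x
... | other x≢a _   = swap-other x≢a x≢a

-- Serves twice below: to reduce a distant transposition to a nearer one, and to trade a
-- transposition of positions for one of values.
swap-conj : (π : Fin n → Fin n) → (∀ {x y} → π x ≡ π y → x ≡ y) →
            ∀ a b x → swap (π a) (π b) (π x) ≡ π (swap a b x)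
swap-conj π inj a b x with swapView a b x
... | left refl     = trans (swap-left (π a) (π b)) (cong π (sym (swap-left a b)))
... | right _ refl  = trans (swap-right (π a) (π b)) (cong π (sym (swap-right a b)))
... | other x≢a x≢b =
  trans (swap-other (x≢a ∘ inj) (x≢b ∘ inj)) (cong π (sym (swap-other x≢a x≢b)))

swap-injective : (a b : Fin n) → ∀ {x y} → swap a b x ≡ swap a b y → x ≡ y
swap-injective a b eq =
  trans (sym (transpose-inverse b a)) (trans (cong (swap b a) eq) (transpose-inverse b a))

swap-involutive : (a b x : Fin n) → swap a b (swap a b x) ≡ x
swap-involutive a b x with swapView a b x
... | left refl     = trans (cong (swap a b) (swap-left a b)) (swap-right a b)
... | right _ refl  = trans (cong (swap a b) (swap-right a b)) (swap-left a b)
... | other x≢a x≢b = trans (cong (swap a b) (swap-other x≢a x≢b)) (swap-other x≢a x≢b)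

⟨$⟩ʳ-injective : (σ : Permutation′ n) → ∀ {x y} → σ ⟨$⟩ʳ x ≡ σ ⟨$⟩ʳ y → x ≡ y
⟨$⟩ʳ-injective σ eq = trans (sym (inverseˡ σ)) (trans (cong (σ ⟨$⟩ˡ_) eq) (inverseˡ σ))

-- The sign of a permutation

module _ {A : Set} {P Q : Pred A 0ℓ} (P? : Decidable P) (Q? : Decidable Q) where

  length-filter-agree : ∀ {xs} → All (λ x → (P x → Q x) × (Q x → P x)) xs →
                        length (filter P? xs) ≡ length (filter Q? xs)
  length-filter-agree [] = refl
  length-filter-agree {x ∷ _} ((p⇒q , q⇒p) ∷ agree) with P? x | Q? x
  ... | yes _ | yes _ = cong ℕ.suc (length-filter-agree agree)
  ... | no _  | no _  = length-filter-agree agree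
  ... | yes p | no ¬q = contradiction (p⇒q p) ¬q
  ... | no ¬p | yes q = contradiction (q⇒p q) ¬p

  -- Meant for the inversions before and after a swap of adjacent values, where a single pair
  -- changes status; uniqueness makes that pair count exactly once.
  length-filter-suc : ∀ {e xs} → Unique xs → e ∈ xs → ¬ P e → Q e →
                      (∀ x → x ≢ e → (P x → Q x) × (Q x → P x)) →
                      length (filter Q? xs) ≡ ℕ.suc (length (filter P? xs))
  length-filter-suc {xs = x ∷ _} (x∉xs ∷ _) (here refl) ¬p q agree with P? x | Q? x
  ... | yes p | _     = contradiction p ¬p
  ... | no _  | no ¬q = contradiction q ¬q
  ... | no _  | yes _ = cong ℕ.suc (sym (length-filter-agree
        (All.map (λ x≢y → agree _ (x≢y ∘ sym)) x∉xs)))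
  length-filter-suc {xs = x ∷ _} (x∉xs ∷ uniq) (there e∈xs) ¬p q agree
    with P? x | Q? x | agree x (All.lookup x∉xs e∈xs)
  ... | yes _ | yes _ | _        = cong ℕ.suc (length-filter-suc uniq e∈xs ¬p q agree)
  ... | no _  | no _  | _        = length-filter-suc uniq e∈xs ¬p q agree
  ... | yes p | no ¬q | p⇒q , _  = contradiction (p⇒q p) ¬q
  ... | no ¬p | yes q | _ , q⇒p  = contradiction (q⇒p q) ¬p

Inversion : Permutation′ n → Fin n × Fin n → Set
Inversion σ (i , j) = i < j × σ ⟨$⟩ʳ j < σ ⟨$⟩ʳ i

inversion? : (σ : Permutation′ n) → Decidable (Inversion σ)
inversion? σ (i , j) = (i <? j) ×-dec (σ ⟨$⟩ʳ j <? σ ⟨$⟩ʳ i)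

sgn-cong : {σ τ : Permutation′ n} → σ ≈ τ → sgn σ ≡ sgn τ
sgn-cong {σ = σ} {τ} σ≈τ = cong (-1ℤ ^ᶻ_)
  (length-filter-agree (inversion? σ) (inversion? τ) {cartesianProduct (allFin _) (allFin _)}
    (All.tabulate λ {(i , j)} _ →
    (λ (i<j , inv) → i<j , subst₂ _<_ (σ≈τ j) (σ≈τ i) inv) ,
    (λ (i<j , inv) → i<j , subst₂ _<_ (sym (σ≈τ j)) (sym (σ≈τ i)) inv)))

module _ {a b : Fin n} (b≡1+a : toℕ b ≡ ℕ.suc (toℕ a)) where

  private
    a<b : a < b
    a<b = ℕ.≤-reflexive (sym b≡1+a)

    above : ∀ {x} → a < x → x ≢ b → b < x
    above a<x x≢b = ℕ.≤∧≢⇒< (subst (ℕ._≤ _) (sym b≡1+a) a<x) (x≢b ∘ toℕ-injective ∘ sym)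

    below : ∀ {x} → x < b → x ≢ a → x < a
    below x<b x≢a = ℕ.≤∧≢⇒< (ℕ.s≤s⁻¹ (subst (_ ℕ.≤_) b≡1+a x<b)) (x≢a ∘ toℕ-injective)

  -- No value lies strictly between `a` and `b`, so a third value compares alike with both; only the
  -- pair itself can change its order.
  swap-adjacent-< : ∀ {x y} → ¬ (x ≡ b × y ≡ a) → y < x → swap a b y < swap a b x
  swap-adjacent-< {x} {y} ¬ba y<x with swapView a b y | swapView a b x
  ... | left refl     | left refl     = contradiction y<x (ℕ.<-irrefl refl)
  ... | left refl     | right _ refl  = contradiction (refl , refl) ¬ba
  ... | left refl     | other x≢a x≢b =
        subst₂ _<_ (sym (swap-left a b)) (sym (swap-other x≢a x≢b)) (above y<x x≢b)
  ... | right _ refl  | left refl     = contradiction a<b (ℕ.<-asym y<x)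
  ... | right _ refl  | right _ refl  = contradiction y<x (ℕ.<-irrefl refl)
  ... | right _ refl  | other x≢a x≢b =
        subst₂ _<_ (sym (swap-right a b)) (sym (swap-other x≢a x≢b)) (ℕ.<-trans a<b y<x)
  ... | other y≢a y≢b | left refl     =
        subst₂ _<_ (sym (swap-other y≢a y≢b)) (sym (swap-left a b)) (ℕ.<-trans y<x a<b)
  ... | other y≢a y≢b | right _ refl  =
        subst₂ _<_ (sym (swap-other y≢a y≢b)) (sym (swap-right a b)) (below y<x y≢a)
  ... | other y≢a y≢b | other x≢a x≢b =
        subst₂ _<_ (sym (swap-other y≢a y≢b)) (sym (swap-other x≢a x≢b)) y<x

  private
    swapped-inverse : ∀ {σ τ : Permutation′ n} → (∀ i → τ ⟨$⟩ʳ i ≡ swap a b (σ ⟨$⟩ʳ i)) →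
                      ∀ i → σ ⟨$⟩ʳ i ≡ swap a b (τ ⟨$⟩ʳ i)
    swapped-inverse τ≡ i =
      trans (sym (swap-involutive a b _)) (cong (swap a b) (sym (τ≡ i)))

    -- The exceptional pair of `swap-adjacent-<` would force `(i , j)` to be `(q , p)` for `σ`,
    -- against `i < j` and `p < q`, and to be `(p , q)` for `τ`. So `(p , q)` is the only pair that
    -- changes status.
    inversions-suc : (σ τ : Permutation′ n) → (∀ i → τ ⟨$⟩ʳ i ≡ swap a b (σ ⟨$⟩ʳ i)) →
                     ∀ {p q} → σ ⟨$⟩ʳ p ≡ a → σ ⟨$⟩ʳ q ≡ b → p < q →
                     length (inversions τ) ≡ ℕ.suc (length (inversions σ))
    inversions-suc σ τ τ≡ {p} {q} σp σq p<q =
      length-filter-suc (inversion? σ) (inversion? τ)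
        (cartesianProduct⁺ (allFin⁺ n) (allFin⁺ n))
        (∈-cartesianProduct⁺ (∈-allFin p) (∈-allFin q))
        (λ (_ , inv) → ℕ.<-asym a<b (subst₂ _<_ σq σp inv))
        (p<q , subst₂ _<_ (sym τq) (sym τp) a<b)
        agree
      where
      τp : τ ⟨$⟩ʳ p ≡ b
      τp = trans (τ≡ p) (trans (cong (swap a b) σp) (swap-left a b))

      τq : τ ⟨$⟩ʳ q ≡ a
      τq = trans (τ≡ q) (trans (cong (swap a b) σq) (swap-right a b))

      agree : ∀ x → x ≢ (p , q) → (Inversion σ x → Inversion τ x) × (Inversion τ x → Inversion σ x)
      agree (i , j) ij≢pq =
        (λ (i<j , inv) → i<j , subst₂ _<_ (sym (τ≡ j)) (sym (τ≡ i))
           (swap-adjacent-< (λ (σi , σj) → ℕ.<-asym p<q (subst₂ _<_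
             (⟨$⟩ʳ-injective σ (trans σi (sym σq))) (⟨$⟩ʳ-injective σ (trans σj (sym σp))) i<j)) inv)) ,
        (λ (i<j , inv) → i<j ,
           subst₂ _<_ (sym (swapped-inverse {σ} {τ} τ≡ j)) (sym (swapped-inverse {σ} {τ} τ≡ i))
           (swap-adjacent-< (λ (τi , τj) → ij≢pq (cong₂ _,_
             (⟨$⟩ʳ-injective τ (trans τi (sym τp))) (⟨$⟩ʳ-injective τ (trans τj (sym τq))))) inv))

  sgn-adjacent : (σ τ : Permutation′ n) → (∀ i → τ ⟨$⟩ʳ i ≡ swap a b (σ ⟨$⟩ʳ i)) →
                 sgn τ ≡ - sgn σ
  sgn-adjacent σ τ τ≡ with <-cmp (σ ⟨$⟩ˡ a) (σ ⟨$⟩ˡ b)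
  ... | tri< p<q _ _ = trans
        (cong (-1ℤ ^ᶻ_) (inversions-suc σ τ τ≡ (inverseʳ σ) (inverseʳ σ) p<q)) (-1*i≡-i _)
  ... | tri≈ _ p≡q _ = contradiction
        (trans (sym (inverseʳ σ)) (trans (cong (σ ⟨$⟩ʳ_) p≡q) (inverseʳ σ))) (<⇒≢ a<b)
  -- In `τ` the value `a` stands before `b`, so the count runs from `τ` to `σ`.
  ... | tri> _ _ q<p = trans (sym (neg-involutive _)) (cong -_ (sym (trans
        (cong (-1ℤ ^ᶻ_) (inversions-suc τ σ (swapped-inverse {σ} {τ} τ≡)
          (trans (τ≡ _) (trans (cong (swap a b) (inverseʳ σ)) (swap-right a b)))
          (trans (τ≡ _) (trans (cong (swap a b) (inverseʳ σ)) (swap-left a b)))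
          q<p))
        (-1*i≡-i _))))

-- Induction on the distance. With `c` just below `b`, the transposition of `a` and `b` is that of
-- `a` and `c` conjugated by the adjacent one of `c` and `b`, so the sign changes three times.
sgn-swap-distance : ∀ d {a b : Fin n} → toℕ b ≡ ℕ.suc d ℕ.+ toℕ a → (σ : Permutation′ n) →
                    sgn (σ ∘ₚ transpose a b) ≡ - sgn σ
sgn-swap-distance ℕ.zero    b≡ σ = sgn-adjacent b≡ σ (σ ∘ₚ transpose _ _) (λ _ → refl)
sgn-swap-distance {n} (ℕ.suc d) {a} {b} b≡ σ = begin
  sgn (σ ∘ₚ transpose a b)
    ≡⟨ sgn-adjacent b≡1+c ρ (σ ∘ₚ transpose a b) conj ⟩
  - sgn ρ
    ≡⟨ cong -_ (sgn-swap-distance d c≡ (σ ∘ₚ transpose c b)) ⟩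
  - - sgn (σ ∘ₚ transpose c b)
    ≡⟨ neg-involutive _ ⟩
  sgn (σ ∘ₚ transpose c b)
    ≡⟨ sgn-adjacent b≡1+c σ (σ ∘ₚ transpose c b) (λ _ → refl) ⟩
  - sgn σ ∎
  where
  open ≡-Reasoning

  c<n : ℕ.suc d ℕ.+ toℕ a ℕ.< n
  c<n = ℕ.<-trans (ℕ.≤-reflexive (sym b≡)) (toℕ<n b)

  c : Fin n
  c = fromℕ< c<n

  c≡ : toℕ c ≡ ℕ.suc d ℕ.+ toℕ a
  c≡ = toℕ-fromℕ< c<n

  b≡1+c : toℕ b ≡ ℕ.suc (toℕ c)
  b≡1+c = trans b≡ (cong ℕ.suc (sym c≡))

  a≢c : a ≢ c
  a≢c a≡c = ℕ.m≢1+n+m (toℕ a) (trans (cong toℕ a≡c) c≡)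

  a≢b : a ≢ b
  a≢b a≡b = ℕ.m≢1+n+m (toℕ a) (trans (cong toℕ a≡b) b≡)

  ρ : Permutation′ n
  ρ = (σ ∘ₚ transpose c b) ∘ₚ transpose a c

  conj : ∀ i → swap a b (σ ⟨$⟩ʳ i) ≡ swap c b (swap a c (swap c b (σ ⟨$⟩ʳ i)))
  conj i = begin
    swap a b y
      ≡⟨ cong₂ (λ u v → swap u v y) (swap-other a≢c a≢b) (swap-left c b) ⟨
    swap (swap c b a) (swap c b c) y
      ≡⟨ cong (swap (swap c b a) (swap c b c)) (swap-involutive c b y) ⟨
    swap (swap c b a) (swap c b c) (swap c b (swap c b y))
      ≡⟨ swap-conj (swap c b) (swap-injective c b) a c (swap c b y) ⟩
    swap c b (swap a c (swap c b y)) ∎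
    where y = σ ⟨$⟩ʳ i

swap-comm : (a b x : Fin n) → swap a b x ≡ swap b a x
swap-comm a b x =
  trans (sym (cong (swap a b) (transpose-inverse a b {x}))) (swap-involutive a b (swap b a x))

sgn-swap : {a b : Fin n} → a ≢ b → (σ : Permutation′ n) → sgn (σ ∘ₚ transpose a b) ≡ - sgn σ
sgn-swap {a = a} {b} a≢b σ with <-cmp a b
... | tri< a<b _ _ = sgn-swap-distance _ (sym (trans (sym (ℕ.+-suc _ _)) (ℕ.m∸n+n≡m a<b))) σ
... | tri≈ _ a≡b _ = contradiction a≡b a≢b
... | tri> _ _ b<a = trans
      (sgn-cong {σ = σ ∘ₚ transpose a b} {σ ∘ₚ transpose b a} (λ i → swap-comm a b (σ ⟨$⟩ʳ i)))
      (sgn-swap-distance _ (sym (trans (sym (ℕ.+-suc _ _)) (ℕ.m∸n+n≡m b<a))) σ)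

sgn-transpose-∘ : {a b : Fin n} → a ≢ b → (σ : Permutation′ n) → sgn (transpose a b ∘ₚ σ) ≡ - sgn σ
sgn-transpose-∘ {a = a} {b} a≢b σ = trans
  (sgn-cong {σ = transpose a b ∘ₚ σ} {σ ∘ₚ transpose (σ ⟨$⟩ʳ a) (σ ⟨$⟩ʳ b)}
    (λ i → sym (swap-conj (σ ⟨$⟩ʳ_) (⟨$⟩ʳ-injective σ) a b i)))
  (sgn-swap (a≢b ∘ ⟨$⟩ʳ-injective σ) σ)

sgn-transpose-self : (a : Fin n) (σ : Permutation′ n) → sgn (transpose a a ∘ₚ σ) ≡ sgn σ
sgn-transpose-self a σ =
  sgn-cong {σ = transpose a a ∘ₚ σ} {σ} (λ i → cong (σ ⟨$⟩ʳ_) (swap-trivial a i))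

-- Effect of one changed letter on the sign.

-- The list of positions is arbitrary so that inductions can consume it; `sefToPerm f` is the case
-- `allFin n`.
walk : SEF n → List (Fin n) → Permutation′ n
walk f is = eval (map (λ i → i , f at i) is)

AgreeOff : Fin n → SEF n → SEF n → Set
AgreeOff c f g = ∀ j → j ≢ c → f at j ≡ g at j

module _ {c : Fin n} (f g : SEF n) (agree : AgreeOff c f g)
         (fc≡c : f at c ≡ c) (gc≢c : g at c ≢ c) where

  private
    unchanged : ∀ {is} → All (c ≢_) is → ∀ x → walk g is ⟨$⟩ʳ x ≡ walk f is ⟨$⟩ʳ x
    unchanged []                              x = refl
    unchanged (_∷_ {x = i} {xs = is} c≢i c∉is) x = trans
      (unchanged c∉is _)
      (cong (λ v → walk f is ⟨$⟩ʳ swap i v x) (sym (agree i (c≢i ∘ sym))))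

    -- The factor at `c` is trivial for `f` and a proper transposition for `g`. Every other factor
    -- is common to both and affects both signs alike.
    flipped : ∀ {is} → Unique is → c ∈ is → sgn (walk g is) ≡ - sgn (walk f is)
    flipped {i ∷ is} (c∉is ∷ _) (here refl) = trans
      (sgn-transpose-∘ (gc≢c ∘ sym) (walk g is))
      (cong -_ (trans (sgn-cong {σ = walk g is} {walk f is} (unchanged c∉is))
        (sym (subst (λ v → sgn (transpose i v ∘ₚ walk f is) ≡ sgn (walk f is))
          (sym fc≡c) (sgn-transpose-self i (walk f is))))))
    flipped {i ∷ is} (i∉is ∷ uniq) (there c∈is)
      rewrite sym (agree i (All.lookup i∉is c∈is)) with i ≟ f at i
    ... | no i≢fi = trans (sgn-transpose-∘ i≢fi (walk g is)) (cong -_ (trans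
          (flipped uniq c∈is) (sym (sgn-transpose-∘ i≢fi (walk f is)))))
    ... | yes i≡fi rewrite sym i≡fi = trans (sgn-transpose-self i (walk g is)) (trans
          (flipped uniq c∈is) (cong -_ (sym (sgn-transpose-self i (walk f is)))))

  sgn-unfix : sgn (sefToPerm g) ≡ - sgn (sefToPerm f)
  sgn-unfix = flipped (allFin⁺ n) (∈-allFin c)

-- The action of sefToPerm f

InImage : SEF n → Fin n → Set
InImage f v = ∃ λ j → f at j ≡ v

-- The words coming from derangements.
DF : SEF n → Set
DF f = ∀ x → f at x ≡ x → ∃ λ j → x < j × f at j ≡ x

Last : SEF n → Fin n → Set
Last f x = ∀ k → x < k → f at k ≢ f at x

last-occurrence : (f : SEF n) (x : Fin n) → ∃ λ k → x ≤ k × f at k ≡ f at x × Last f k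
last-occurrence f x = go x (>-wellFounded x)
  where
  go : ∀ x → Acc _>_ x → ∃ λ k → x ≤ k × f at k ≡ f at x × Last f k
  go x (acc later) with any? (λ k → (x <? k) ×-dec (f at k ≟ f at x))
  ... | no none = x , ℕ.≤-refl , refl , λ k x<k eq → none (k , x<k , eq)
  ... | yes (y , x<y , fy≡fx) with go y (later x<y)
  ...   | k , y≤k , fk≡fy , last = k , ℕ.<⇒≤ (ℕ.<-≤-trans x<y y≤k) , trans fk≡fy fy≡fx , last

module _ (f : SEF n) where

  private
    -- Since `y` lies below all remaining positions, only a letter equal to `y` can move it, namely
    -- to the position of that letter, which again lies below all later ones. The place finally
    -- reached is missed by every letter: those up to that position are smaller, and a later one
    -- would have moved it on.
    track : ∀ {is} → AllPairs _<_ is → ∀ {y} → All (y <_) is →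
            (walk f is ⟨$⟩ʳ y ≡ y × All (λ k → f at k ≢ y) is)
          ⊎ (Any (λ k → f at k ≡ y) is
             × walk f is ⟨$⟩ʳ y ∈ is × All (λ k → f at k ≢ walk f is ⟨$⟩ʳ y) is)
    track [] [] = inj₁ (refl , [])
    track {i ∷ is} (i<is ∷ sorted) {y} (y<i ∷ y<is) with swapView i (f at i) y
    ... | left refl = contradiction y<i (ℕ.<-irrefl refl)
    ... | other y≢i y≢fi rewrite swap-other y≢i y≢fi with track sorted y<is
    ...   | inj₁ (eq , miss) = inj₁ (eq , (y≢fi ∘ sym) ∷ miss)
    ...   | inj₂ (hit , r∈is , miss) = inj₂ (there hit , there r∈is ,
            (<⇒≢ (ℕ.≤-<-trans (at-≤ f i) (All.lookup i<is r∈is))) ∷ miss)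
    track {i ∷ is} (i<is ∷ sorted) {y} (y<i ∷ y<is) | right y≢i refl
      rewrite swap-right i (f at i) with track sorted i<is
    ...   | inj₁ (eq , miss) rewrite eq = inj₂ (here refl , here refl , y≢i ∷ miss)
    ...   | inj₂ (hit , r∈is , miss) = inj₂ (here refl , there r∈is ,
            (<⇒≢ (ℕ.≤-<-trans (at-≤ f i) (All.lookup i<is r∈is))) ∷ miss)

    -- Positions before `x` involve only numbers below `x`. So `x` is first affected at its own
    -- position, which sends it to `f at x`, and `track` takes over from there.
    trackFrom : ∀ {is} → AllPairs _<_ is → ∀ {x} → x ∈ is →
            (walk f is ⟨$⟩ʳ x ≡ f at x × All (λ k → x < k → f at k ≢ f at x) is)
          ⊎ (Any (λ k → x < k × f at k ≡ f at x) is
             × x < walk f is ⟨$⟩ʳ x × All (λ k → f at k ≢ walk f is ⟨$⟩ʳ x) is)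
    trackFrom {i ∷ is} (i<is ∷ sorted) (here refl)
      rewrite swap-left i (f at i)
      with track sorted (All.map (ℕ.≤-<-trans (at-≤ f i)) i<is)
    ... | inj₁ (eq , miss) = inj₁ (eq , (λ i<i → contradiction i<i (ℕ.<-irrefl refl)) ∷
          All.map (λ neq _ → neq) miss)
    ... | inj₂ (hit , r∈is , miss) = inj₂
          (there (zip i<is hit) , All.lookup i<is r∈is ,
          (<⇒≢ (ℕ.≤-<-trans (at-≤ f i) (All.lookup i<is r∈is))) ∷ miss)
      where
      zip : ∀ {P Q : Pred (Fin n) 0ℓ} {js} → All P js → Any Q js → Any (λ k → P k × Q k) js
      zip (p ∷ _)  (here q)  = here (p , q)
      zip (_ ∷ ps) (there q) = there (zip ps q)
    trackFrom {i ∷ is} (i<is ∷ sorted) {x} (there x∈is)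
      rewrite swap-other {a = i} {f at i} {x} (<⇒≢ (All.lookup i<is x∈is) ∘ sym)
                (<⇒≢ (ℕ.≤-<-trans (at-≤ f i) (All.lookup i<is x∈is)) ∘ sym)
      with trackFrom sorted x∈is
    ... | inj₁ (eq , miss) = inj₁ (eq ,
          (λ x<i → contradiction (All.lookup i<is x∈is) (ℕ.<-asym x<i)) ∷ miss)
    ... | inj₂ (hit , x<r , miss) = inj₂ (there hit , x<r ,
          (<⇒≢ (ℕ.≤-<-trans (at-≤ f i) (ℕ.<-trans (All.lookup i<is x∈is) x<r))) ∷ miss)

  private
    σ : Permutation′ n
    σ = sefToPerm f

  sefToPerm-action : ∀ x →
      (σ ⟨$⟩ʳ x ≡ f at x × Last f x)
    ⊎ ((∃ λ k → x < k × f at k ≡ f at x) × x < σ ⟨$⟩ʳ x × ¬ InImage f (σ ⟨$⟩ʳ x))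
  sefToPerm-action x with trackFrom (AllPairs.tabulate⁺-< id) (∈-allFin x)
  ... | inj₁ (eq , miss)        = inj₁ (eq , λ k → All.lookup miss (∈-allFin k))
  ... | inj₂ (hit , x<r , miss) =
        inj₂ (Any.satisfied hit , x<r , λ (j , fj≡) → All.lookup miss (∈-allFin j) fj≡)

  sefToPerm-last : ∀ {x} → Last f x → σ ⟨$⟩ʳ x ≡ f at x
  sefToPerm-last {x} last with sefToPerm-action x
  ... | inj₁ (eq , _)              = eq
  ... | inj₂ ((k , x<k , eq) , _) = contradiction eq (last k x<k)

  derangement⇒DF : IsDerangement σ → DF f
  derangement⇒DF der x fx≡x with sefToPerm-action x
  ... | inj₁ (σx≡fx , _)               = contradiction (trans σx≡fx fx≡x) (der x)
  ... | inj₂ ((k , x<k , fk≡fx) , _) = k , x<k , trans fk≡fx fx≡x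

  DF⇒derangement : DF f → IsDerangement σ
  DF⇒derangement df x σx≡x with sefToPerm-action x
  ... | inj₂ (_ , x<σx , _) = <⇒≢ x<σx (sym σx≡x)
  ... | inj₁ (σx≡fx , last) with df x (trans (sym σx≡fx) σx≡x)
  ...   | k , x<k , fk≡x = last k x<k (trans fk≡x (trans (sym σx≡x) σx≡fx))

  excedance⇒missed : ∀ {v} → EXCv σ v → ¬ InImage f v
  excedance⇒missed (x , refl , x<σx) with sefToPerm-action x
  ... | inj₁ (σx≡fx , _)   = contradiction (at-≤ f x) (ℕ.<⇒≱ (subst (x <_) σx≡fx x<σx))
  ... | inj₂ (_ , _ , miss) = miss

  missed⇒excedance : ∀ {v} → ¬ InImage f v → EXCv σ v
  missed⇒excedance {v} miss with sefToPerm-action (σ ⟨$⟩ˡ v)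
  ... | inj₁ (σx≡fx , _)   = contradiction (_ , trans (sym σx≡fx) (inverseʳ σ)) miss
  ... | inj₂ (_ , x<σx , _) = _ , inverseʳ σ , x<σx

  WordMin : Fin n → Set
  WordMin v = InImage f v × (∀ j → f at j < v → ∃ λ k → j < k × f at k ≡ v)

  -- A letter is attained as a value at its last occurrence. If `x` were an excedance, the last
  -- occurrence of `f at x` would lie beyond `x` and have a smaller value than `x` has. Otherwise
  -- `x` is the last occurrence of its letter, and a smaller letter beyond `x` would be attained
  -- there too, against minimality.
  RLMv⇒WordMin : ∀ {v} → RLMv σ v → WordMin v
  RLMv⇒WordMin (x , refl , min) with sefToPerm-action x
  ... | inj₂ ((k , x<k , fk≡fx) , x<σx , _) with last-occurrence f k
  ...   | m , k≤m , fm≡fk , last = contradiction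
          (subst (σ ⟨$⟩ʳ x <_) (trans (sefToPerm-last last) (trans fm≡fk fk≡fx))
            (min m (ℕ.<-≤-trans x<k k≤m)))
          (ℕ.≤⇒≯ (ℕ.≤-trans (at-≤ f x) (ℕ.<⇒≤ x<σx)))
  RLMv⇒WordMin (x , refl , min) | inj₁ (σx≡fx , last) = (x , sym σx≡fx) , after
    where
    after : ∀ j → f at j < σ ⟨$⟩ʳ x → ∃ λ k → j < k × f at k ≡ σ ⟨$⟩ʳ x
    after j fj<v with <-cmp j x
    ... | tri< j<x _ _ = x , j<x , sym σx≡fx
    ... | tri≈ _ refl _ = contradiction (sym (cong toℕ σx≡fx)) (ℕ.<⇒≢ fj<v)
    ... | tri> _ _ x<j with last-occurrence f j
    ...   | m , j≤m , fm≡fj , last-m = contradiction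
            (subst (σ ⟨$⟩ʳ x <_) (trans (sefToPerm-last last-m) fm≡fj) (min m (ℕ.<-≤-trans x<j j≤m)))
            (ℕ.<-asym fj<v)

  -- Beyond the last `v` every letter exceeds `v`, since a smaller one would be followed by another
  -- `v`. The value at `j` is never below `f at j`, so the values beyond exceed `v` as well.
  WordMin⇒RLMv : ∀ {v} → WordMin v → RLMv σ v
  WordMin⇒RLMv {v} ((i , refl) , after) with last-occurrence f i
  ... | x , _ , fx≡v , last = x , σx≡v , min
    where
    σx≡v : σ ⟨$⟩ʳ x ≡ v
    σx≡v = trans (sefToPerm-last last) fx≡v

    above : ∀ j → x < j → v < f at j
    above j x<j with <-cmp v (f at j)
    ... | tri< v<fj _ _ = v<fj
    ... | tri≈ _ v≡fj _ = contradiction (trans (sym v≡fj) (sym fx≡v)) (last j x<j)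
    ... | tri> _ _ fj<v with after j fj<v
    ...   | k , j<k , fk≡v = contradiction (trans fk≡v (sym fx≡v)) (last k (ℕ.<-trans x<j j<k))

    min : ∀ j → x < j → σ ⟨$⟩ʳ x < σ ⟨$⟩ʳ j
    min j x<j with sefToPerm-action j
    ... | inj₁ (σj≡fj , _)    = subst₂ _<_ (sym σx≡v) (sym σj≡fj) (above j x<j)
    ... | inj₂ (_ , j<σj , _) =
          subst (_< σ ⟨$⟩ʳ j) (sym σx≡v) (ℕ.<-trans (ℕ.<-≤-trans (above j x<j) (at-≤ f j)) j<σj)

-- Pivots and toggles.

-- The place p < c where Ψ toggles the value at c between c and p. No condition
-- depends on which of the two values is present, so a pivot survives its own toggle.
record Pivot (f : SEF n) (p c : Fin n) : Set where
  field
    p<c     : p < c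
    gap     : ∀ j → p < f at j → c ≤ f at j
    at-c    : f at c ≡ c ⊎ f at c ≡ p
    p-hit   : ∃ λ j → p < j × j ≢ c × f at j ≡ p
    c-hit   : ∃ λ j → c < j × f at j ≡ c
    p-moves : 0 ℕ.< toℕ p → f at p ≢ p
    quiet   : ∀ j → 0 ℕ.< toℕ j → f at j < p → toℕ j ≡ ℕ.suc (toℕ (f at j))

  c-moved : f at c ≢ c → f at c ≡ p
  c-moved fc≢c with at-c
  ... | inj₁ fc≡c = contradiction fc≡c fc≢c
  ... | inj₂ fc≡p = fc≡p

  -- A letter below `p` stands at position zero or, by `quiet`, one step beyond its own value. Hence
  -- an occurrence of `p` beyond position `p` follows every such letter.
  p-positions : ∀ j → f at j < p → j ≤ p
  p-positions j fj<p with toℕ j ℕ.≟ 0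
  ... | yes j≡0 = subst (ℕ._≤ toℕ p) (sym j≡0) z≤n
  ... | no  j≢0 = subst (ℕ._≤ toℕ p) (sym (quiet j (ℕ.n≢0⇒n>0 j≢0) fj<p)) fj<p

-- The direction is left open; this makes the relation symmetric, so that each one-way invariance
-- lemma yields its converse.
record Toggle (p c : Fin n) (f g : SEF n) : Set where
  constructor toggle
  field
    agree  : AgreeOff c f g
    values : (f at c ≡ c × g at c ≡ p) ⊎ (f at c ≡ p × g at c ≡ c)

  new-value : g at c ≡ c ⊎ g at c ≡ p
  new-value = [ inj₂ ∘ proj₂ , inj₁ ∘ proj₂ ]′ values

toggle-sym : {p c : Fin n} {f g : SEF n} → Toggle p c f g → Toggle p c g f
toggle-sym (toggle agree values) = toggle (λ j j≢c → sym (agree j j≢c))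
  ([ (λ (fc , gc) → inj₂ (gc , fc)) , (λ (fc , gc) → inj₁ (gc , fc)) ]′ values)

toggle-twice-at : {p c : Fin n} {f g h : SEF n} → p ≢ c →
                  Toggle p c f g → Toggle p c g h → f at c ≡ h at c
toggle-twice-at p≢c (toggle _ (inj₁ (_ , gc≡p))) (toggle _ (inj₁ (gc≡c , _))) =
  contradiction (trans (sym gc≡p) gc≡c) p≢c
toggle-twice-at p≢c (toggle _ (inj₁ (fc≡c , _))) (toggle _ (inj₂ (_ , hc≡c))) = trans fc≡c (sym hc≡c)
toggle-twice-at p≢c (toggle _ (inj₂ (fc≡p , _))) (toggle _ (inj₁ (_ , hc≡p))) = trans fc≡p (sym hc≡p)
toggle-twice-at p≢c (toggle _ (inj₂ (_ , gc≡c))) (toggle _ (inj₂ (gc≡p , _))) =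
  contradiction (trans (sym gc≡p) gc≡c) p≢c

toggle-twice : {p c : Fin n} {f g h : SEF n} → p ≢ c → Toggle p c f g → Toggle p c g h → f ≡ h
toggle-twice {c = c} {f} {g} {h} p≢c fg gh = SEF-ext same
  where
  same : ∀ i → f at i ≡ h at i
  same i with i ≟ c
  ... | yes refl = toggle-twice-at p≢c fg gh
  ... | no  i≢c  = trans (Toggle.agree fg i i≢c) (Toggle.agree gh i i≢c)

module _ {f g : SEF n} {p c : Fin n} (tog : Toggle p c f g) (piv : Pivot f p c) where

  open Pivot piv
  open Toggle tog using (agree) renaming (new-value to gc)

  private
    move : ∀ {j v} → j ≢ c → f at j ≡ v → g at j ≡ v
    move j≢c fj≡v = trans (sym (agree _ j≢c)) fj≡v

    value-at-c : ∀ {v} → f at c ≡ v → v ≡ c ⊎ v ≡ p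
    value-at-c fc≡v with at-c
    ... | inj₁ fc≡c = inj₁ (trans (sym fc≡v) fc≡c)
    ... | inj₂ fc≡p = inj₂ (trans (sym fc≡v) fc≡p)

    p-hit′ : ∃ λ j → p < j × j ≢ c × g at j ≡ p
    p-hit′ with p-hit
    ... | j , p<j , j≢c , fj≡p = j , p<j , j≢c , move j≢c fj≡p

    c-hit′ : ∃ λ j → c < j × g at j ≡ c
    c-hit′ with c-hit
    ... | j , c<j , fj≡c = j , c<j , move (<⇒≢ c<j ∘ sym) fj≡c

    -- Only an occurrence at `c` can be lost. It carried `c` or `p`, and these occur again beyond
    -- `c` and beyond `p` respectively; the latter is beyond `x` once `x ≤ p`.
    hit-beyond : ∀ (x : Fin n) {v} → (v ≡ p → x ≤ p) → (∃ λ j → x < j × f at j ≡ v) →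
                 ∃ λ j → x < j × g at j ≡ v
    hit-beyond x v≡p⇒x≤p (j , x<j , fj≡v) with j ≟ c
    ... | no j≢c = j , x<j , move j≢c fj≡v
    ... | yes refl with value-at-c fj≡v | c-hit′ | p-hit′
    ...   | inj₁ refl | k , c<k , gk≡c | _ = k , ℕ.<-trans x<j c<k , gk≡c
    ...   | inj₂ refl | _ | k , p<k , _ , gk≡p = k , ℕ.≤-<-trans (v≡p⇒x≤p refl) p<k , gk≡p

  -- The letter at `c` is `c` or `p` before and after, and neither can violate `gap` or `quiet`. The
  -- two hits and `p-moves` concern other places.
  toggle-pivot : Pivot g p c
  toggle-pivot = record
    { p<c     = p<c
    ; gap     = gap′
    ; at-c    = gc
    ; p-hit   = p-hit′
    ; c-hit   = c-hit′
    ; p-moves = λ 0<p gp≡p → p-moves 0<p (trans (agree p (<⇒≢ p<c)) gp≡p)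
    ; quiet   = quiet′
    }
    where
    gap′ : ∀ j → p < g at j → c ≤ g at j
    gap′ j p<gj with j ≟ c
    ... | no j≢c = subst (c ≤_) (agree j j≢c) (gap j (subst (p <_) (sym (agree j j≢c)) p<gj))
    ... | yes refl = [ (λ gc≡c → ℕ.≤-reflexive (cong toℕ (sym gc≡c)))
                     , (λ gc≡p → contradiction (sym gc≡p) (<⇒≢ p<gj)) ]′ gc

    quiet′ : ∀ j → 0 ℕ.< toℕ j → g at j < p → toℕ j ≡ ℕ.suc (toℕ (g at j))
    quiet′ j 0<j gj<p with j ≟ c
    ... | no j≢c = subst (λ v → toℕ j ≡ ℕ.suc (toℕ v)) (agree j j≢c)
                     (quiet j 0<j (subst (_< p) (sym (agree j j≢c)) gj<p))
    ... | yes refl = [ (λ gc≡c → contradiction p<c (ℕ.<-asym (subst (_< p) gc≡c gj<p)))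
                     , (λ gc≡p → contradiction gc≡p (<⇒≢ gj<p)) ]′ gc

  toggle-image : ∀ {v} → InImage f v → InImage g v
  toggle-image (j , fj≡v) with j ≟ c
  ... | no j≢c = j , move j≢c fj≡v
  ... | yes refl with value-at-c fj≡v | c-hit′ | p-hit′
  ...   | inj₁ refl | k , _ , gk≡c | _ = k , gk≡c
  ...   | inj₂ refl | _ | k , _ , _ , gk≡p = k , gk≡p

  toggle-DF : DF f → DF g
  toggle-DF df x gx≡x with x ≟ c
  ... | yes refl = c-hit′
  ... | no x≢c   = hit-beyond x (λ x≡p → ℕ.≤-reflexive (cong toℕ x≡p))
                     (df x (trans (agree x x≢c) gx≡x))

  toggle-WordMin : ∀ {v} → WordMin f v → WordMin g v
  toggle-WordMin {v} ((i , fi≡v) , after) = toggle-image (i , fi≡v) , after′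
    where
    after′ : ∀ j → g at j < v → ∃ λ k → j < k × g at k ≡ v
    after′ j gj<v with j ≟ c
    ... | no j≢c = hit-beyond j (λ {refl → p-positions j fj<v}) (after j fj<v)
      where
      fj<v : f at j < v
      fj<v = subst (_< v) (sym (agree j j≢c)) gj<v
    -- Here `j` is `c`. Its letter is at least `p`, so `v` exceeds `p` and `gap` gives `c ≤ v`. If
    -- `v` exceeds `c`, the old letter at `c` is below `v` as well, whichever it was.
    ... | yes refl with v ≟ j
    ...   | yes refl = c-hit′
    ...   | no  v≢c  = hit-beyond j (λ {refl → contradiction p<v (ℕ.<-irrefl refl)}) (after j fc<v)
      where
      p≤gc : p ≤ g at j
      p≤gc = [ (λ gc≡c → subst (p ≤_) (sym gc≡c) (ℕ.<⇒≤ p<c))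
             , (λ gc≡p → ℕ.≤-reflexive (cong toℕ (sym gc≡p))) ]′ gc

      p<v : p < v
      p<v = ℕ.≤-<-trans p≤gc gj<v

      c<v : j < v
      c<v = ℕ.≤∧≢⇒< (subst (j ≤_) fi≡v (gap i (subst (p <_) (sym fi≡v) p<v)))
                    (v≢c ∘ sym ∘ toℕ-injective)

      fc<v : f at j < v
      fc<v with at-c
      ... | inj₁ fc≡c = subst (_< v) (sym fc≡c) c<v
      ... | inj₂ fc≡p = subst (_< v) (sym fc≡p) p<v

module _ {f : SEF n} {p c : Fin n} (piv : Pivot f p c) where

  open Pivot piv

  private
    0<c : 0 ℕ.< toℕ c
    0<c = ℕ.≤-<-trans z≤n p<c

  -- A matchless word fixes only the first position, so the letter at `c` is `p`. Being below `k`,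
  -- the letter `p` occurs beyond position `p` only at the next one, yet `p-hit` gives a second such
  -- place. Hence `Ψ` toggles again when applied to `Ψ f`.
  pivot⇒¬matchless : ¬ Matchless f
  pivot⇒¬matchless (k , _ , word≡) = go p-hit c-hit
    where
    value : ∀ j → 0 ℕ.< toℕ j → ℕ.suc (toℕ (f at j)) ≡ toℕ j ⊓ ℕ.suc (toℕ k)
    value j 0<j = proj₂ (word≡ j) (s≤s 0<j)

    go : (∃ λ j → p < j × j ≢ c × f at j ≡ p) → (∃ λ j → c < j × f at j ≡ c) → ⊥
    go (j , p<j , j≢c , fj≡p) (i , c<i , fi≡c) = j≢c (toℕ-injective (trans
        (sym (below j p<j fj≡p)) (below c p<c (c-moved fc≢c))))
      where
      c≤k : toℕ c ℕ.≤ toℕ k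
      c≤k = ℕ.s≤s⁻¹ (ℕ.≤-trans
        (ℕ.≤-reflexive (trans (cong (ℕ.suc ∘ toℕ) (sym fi≡c)) (value i (ℕ.<-trans 0<c c<i))))
        (ℕ.m⊓n≤n (toℕ i) _))

      fc≢c : f at c ≢ c
      fc≢c fc≡c = ℕ.<-irrefl (cong toℕ fc≡c)
        (ℕ.≤-trans (ℕ.≤-reflexive (value c 0<c)) (ℕ.m⊓n≤m (toℕ c) _))

      below : ∀ j → p < j → f at j ≡ p → ℕ.suc (toℕ p) ≡ toℕ j
      below j p<j fj≡p with ℕ.≤-total (toℕ j) (ℕ.suc (toℕ k))
      ... | inj₁ j≤1+k = trans (cong (ℕ.suc ∘ toℕ) (sym fj≡p))
            (trans (value j (ℕ.≤-<-trans z≤n p<j)) (ℕ.m≤n⇒m⊓n≡m j≤1+k))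
      ... | inj₂ 1+k≤j = contradiction (ℕ.suc-injective
            (trans (cong (ℕ.suc ∘ toℕ) (sym fj≡p))
              (trans (value j (ℕ.≤-<-trans z≤n p<j)) (ℕ.m≥n⇒m⊓n≡n 1+k≤j))))
            (ℕ.<⇒≢ (ℕ.<-≤-trans p<c c≤k))

pivot-image-p : {f : SEF n} {p c : Fin n} → Pivot f p c → InImage f p
pivot-image-p piv with Pivot.p-hit piv
... | j , _ , _ , fj≡p = j , fj≡p

pivot-image-c : {f : SEF n} {p c : Fin n} → Pivot f p c → InImage f c
pivot-image-c piv with Pivot.c-hit piv
... | j , _ , fj≡c = j , fj≡c

-- Below p′ only the position p + 1 may carry the value p, but c and p-hit are two such positions.
pivot-not-below : {f : SEF n} {p p′ c c′ : Fin n} → Pivot f p c → Pivot f p′ c′ → ¬ (p < p′)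
pivot-not-below {f = f} {p} {p′} {c} {c′} piv piv′ p<p′ with P.p-hit
  where module P = Pivot piv
... | j , p<j , j≢c , fj≡p = j≢c (toℕ-injective (trans (only j p<j fj≡p) (sym (only c P.p<c fc≡p))))
  where
  module P = Pivot piv
  module P′ = Pivot piv′

  only : ∀ i → p < i → f at i ≡ p → toℕ i ≡ ℕ.suc (toℕ p)
  only i p<i refl = P′.quiet i (ℕ.≤-<-trans z≤n p<i) p<p′

  c≤p′ : c ≤ p′
  c≤p′ with pivot-image-p piv′
  ... | i , refl = P.gap i p<p′

  fc≢c : f at c ≢ c
  fc≢c fc≡c with c ≟ p′
  ... | yes refl = P′.p-moves (ℕ.≤-<-trans z≤n P.p<c) fc≡c
  ... | no c≢p′ = ℕ.1+n≢n (sym (trans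
        (P′.quiet c (ℕ.≤-<-trans z≤n P.p<c)
          (subst (_< p′) (sym fc≡c) (ℕ.≤∧≢⇒< c≤p′ (c≢p′ ∘ toℕ-injective))))
        (cong (ℕ.suc ∘ toℕ) fc≡c)))

  fc≡p : f at c ≡ p
  fc≡p = P.c-moved fc≢c

-- By `pivot-not-below` neither of `p` and `p′` is smaller. Once they agree, `gap` makes both `c`
-- and `c′` the least image value above `p`.
pivot-unique : {f : SEF n} {p p′ c c′ : Fin n} → Pivot f p c → Pivot f p′ c′ → p ≡ p′ × c ≡ c′
pivot-unique {f = f} {p} {p′} {c} {c′} piv piv′ with <-cmp p p′
... | tri< p<p′ _ _ = contradiction p<p′ (pivot-not-below piv piv′)
... | tri> _ _ p′<p = contradiction p′<p (pivot-not-below piv′ piv)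
... | tri≈ _ refl _ = refl , toℕ-injective (ℕ.≤-antisym (c≤ piv piv′) (c≤ piv′ piv))
  where
  c≤ : ∀ {c c′} → Pivot f p c → Pivot f p c′ → c ≤ c′
  c≤ piv piv′ with pivot-image-c piv′
  ... | i , refl = Pivot.gap piv i (Pivot.p<c piv′)

-- The image in increasing order

index-below : (x : Fin n) → ∀ {k} → k ℕ.≤ toℕ x → ∃ λ (y : Fin n) → toℕ y ≡ k
index-below x k≤x = fromℕ< (ℕ.≤-<-trans k≤x (toℕ<n x)) , toℕ-fromℕ< _

last-index : Fin n → ∃ λ (i : Fin n) → ⟦ i ⟧ ≡ n
last-index {ℕ.suc n} _ = fromℕ n , cong ℕ.suc (toℕ-fromℕ n)

suc-pred : (i : Fin n) → 2 ℕ.≤ ⟦ i ⟧ → ⟦ i ⟧ ≡ ⟦ pred i ⟧ ℕ.+ 1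
suc-pred zero    (s≤s ())
suc-pred (suc i) _ = trans (cong (ℕ.suc ∘ ℕ.suc) (sym (toℕ-inject₁ i))) (ℕ.+-comm 1 _)

∣p∪q∣≤∣p∣+∣q∣ : (p q : Subset n) → ∣ p ∪ q ∣ ℕ.≤ ∣ p ∣ ℕ.+ ∣ q ∣
∣p∪q∣≤∣p∣+∣q∣ []            []            = z≤n
∣p∪q∣≤∣p∣+∣q∣ (inside ∷ p)  (inside ∷ q)  =
  s≤s (ℕ.≤-trans (∣p∪q∣≤∣p∣+∣q∣ p q) (ℕ.+-monoʳ-≤ ∣ p ∣ (ℕ.n≤1+n ∣ q ∣)))
∣p∪q∣≤∣p∣+∣q∣ (inside ∷ p)  (outside ∷ q) = s≤s (∣p∪q∣≤∣p∣+∣q∣ p q)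
∣p∪q∣≤∣p∣+∣q∣ (outside ∷ p) (inside ∷ q)  =
  ℕ.≤-trans (s≤s (∣p∪q∣≤∣p∣+∣q∣ p q)) (ℕ.≤-reflexive (sym (ℕ.+-suc ∣ p ∣ ∣ q ∣)))
∣p∪q∣≤∣p∣+∣q∣ (outside ∷ p) (outside ∷ q) = ∣p∪q∣≤∣p∣+∣q∣ p q

-- Otherwise the set would lie in a union of two singletons. In case `♠` this third preimage of the
-- least value becomes `p-hit`.
3≤∣p∣⇒third : (p : Subset n) → 3 ℕ.≤ ∣ p ∣ → ∀ a b → ∃ λ x → x ∈ₛ p × x ≢ a × x ≢ b
3≤∣p∣⇒third p 3≤ a b with any? (λ x → (x ∈? p) ×-dec (¬? (x ≟ a) ×-dec ¬? (x ≟ b)))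
... | yes third = third
... | no none = contradiction (ℕ.≤-trans 3≤ (ℕ.≤-trans (p⊆q⇒∣p∣≤∣q∣ p⊆ab)
      (ℕ.≤-trans (∣p∪q∣≤∣p∣+∣q∣ ⁅ a ⁆ ⁅ b ⁆)
        (ℕ.≤-reflexive (cong₂ ℕ._+_ (∣⁅x⁆∣≡1 a) (∣⁅x⁆∣≡1 b)))))) (ℕ.<-irrefl refl)
  where
  p⊆ab : ∀ {x} → x ∈ₛ p → x ∈ₛ ⁅ a ⁆ ∪ ⁅ b ⁆
  p⊆ab {x} x∈p with x ≟ a | x ≟ b
  ... | yes refl | _        = x∈p∪q⁺ (inj₁ (x∈⁅x⁆ x))
  ... | no _     | yes refl = x∈p∪q⁺ (inj₂ (x∈⁅x⁆ x))
  ... | no x≢a   | no x≢b   = contradiction (x , x∈p , x≢a , x≢b) none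

distinct⇒3≤∣p∣ : {p : Subset n} {a b c : Fin n} → a ∈ₛ p → b ∈ₛ p → c ∈ₛ p →
                 b ≢ a → c ≢ a → c ≢ b → 3 ℕ.≤ ∣ p ∣
distinct⇒3≤∣p∣ a∈p b∈p c∈p b≢a c≢a c≢b = ℕ.≤-trans
  (s≤s (ℕ.≤-trans (s≤s (ℕ.≤-<-trans z≤n
    (x∈p⇒∣p-x∣<∣p∣ (x∈p∧x≢y⇒x∈p-y (x∈p∧x≢y⇒x∈p-y c∈p c≢a) c≢b))))
    (x∈p⇒∣p-x∣<∣p∣ (x∈p∧x≢y⇒x∈p-y b∈p b≢a))))
  (x∈p⇒∣p-x∣<∣p∣ a∈p)

module _ {one two : Fin n} (one≡ : ⟦ one ⟧ ≡ 1) (two≡ : ⟦ two ⟧ ≡ 2) where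

  pair⁺ : ∀ {x} → toℕ x ℕ.≤ 1 → x ∈ₛ ⁅ one ⁆ ∪ ⁅ two ⁆
  pair⁺ {x} x≤1 with toℕ x ℕ.≟ 0
  ... | yes x≡0 = x∈p∪q⁺ (inj₁ (subst (_∈ₛ ⁅ one ⁆)
        (toℕ-injective (trans (ℕ.suc-injective one≡) (sym x≡0))) (x∈⁅x⁆ one)))
  ... | no  x≢0 = x∈p∪q⁺ (inj₂ (subst (_∈ₛ ⁅ two ⁆)
        (toℕ-injective (trans (ℕ.suc-injective two≡) (ℕ.≤-antisym (ℕ.n≢0⇒n>0 x≢0) x≤1))) (x∈⁅x⁆ two)))

  pair⁻ : ∀ {x} → x ∈ₛ ⁅ one ⁆ ∪ ⁅ two ⁆ → toℕ x ℕ.≤ 1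
  pair⁻ x∈ with x∈p∪q⁻ ⁅ one ⁆ ⁅ two ⁆ x∈
  ... | inj₁ x∈one rewrite x∈⁅y⁆⇒x≡y one x∈one = ℕ.≤-trans (ℕ.s≤s⁻¹ (ℕ.≤-reflexive one≡)) z≤n
  ... | inj₂ x∈two rewrite x∈⁅y⁆⇒x≡y two x∈two = ℕ.s≤s⁻¹ (ℕ.≤-reflexive two≡)

AllPairs-lookup : ∀ {xs : List (Fin n)} → AllPairs _<_ xs → ∀ {i j} → i < j → lookup xs i < lookup xs j
AllPairs-lookup (x<xs ∷ _)   {zero}  {suc j} _         = All.lookup x<xs (∈-lookup j)
AllPairs-lookup (_ ∷ sorted) {suc i} {suc j} (s≤s i<j) = AllPairs-lookup sorted i<j

module _ (f : SEF n) where

  at-zero : ∀ x → toℕ x ≡ 0 → f at x ≡ x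
  at-zero x x≡0 = toℕ-injective (trans (ℕ.n≤0⇒n≡0 (subst (toℕ (f at x) ℕ.≤_) x≡0 (at-≤ f x))) (sym x≡0))

  moved-< : ∀ {x} → f at x ≢ x → f at x < x
  moved-< {x} fx≢x = ℕ.≤∧≢⇒< (at-≤ f x) (fx≢x ∘ toℕ-injective)

  -- A fixed letter recurs by `DF`. If `v` is not fixed, any occurrence of it lies strictly beyond
  -- `v`, because letters do not exceed their positions.
  later-hit : DF f → ∀ {v} → InImage f v → ∃ λ j → v < j × f at j ≡ v
  later-hit df {v} (j , fj≡v) with f at v ≟ v
  ... | yes fv≡v = df v fv≡v
  ... | no  fv≢v = j , ℕ.≤∧≢⇒< (subst (_≤ j) fj≡v (at-≤ f j))
                         (λ v≡j → fv≢v (trans (cong (f at_) (toℕ-injective v≡j)) fj≡v)) , fj≡v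

  image-𝐦 : ∀ i → InImage f (𝐦 f i)
  image-𝐦 i = proj₂ (∈-filter⁻ (λ v → any? λ j → f at j ≟ v) {xs = allFin n} (∈-lookup i))

  index : ∀ {v} → InImage f v → ∃ λ i → 𝐦 f i ≡ v
  index {v} im = Any.index v∈IM , sym (lookup-index v∈IM)
    where
    v∈IM : v ∈ IM f
    v∈IM = ∈-filter⁺ (λ v → any? λ j → f at j ≟ v) (∈-allFin v) im

  𝐦-mono-< : ∀ {i j} → i < j → 𝐦 f i < 𝐦 f j
  𝐦-mono-< = AllPairs-lookup (AllPairs.filter⁺ _ (AllPairs.tabulate⁺-< id))

  𝐦-mono-≤ : ∀ {i j} → i ≤ j → 𝐦 f i ≤ 𝐦 f j
  𝐦-mono-≤ {i} {j} i≤j with i ≟ j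
  ... | yes refl = ℕ.≤-refl
  ... | no  i≢j  = ℕ.<⇒≤ (𝐦-mono-< (ℕ.≤∧≢⇒< i≤j (i≢j ∘ toℕ-injective)))

  𝐦-cancel-< : ∀ {i j} → 𝐦 f i < 𝐦 f j → i < j
  𝐦-cancel-< {i} {j} mi<mj with i <? j
  ... | yes i<j = i<j
  ... | no  i≮j = contradiction mi<mj (ℕ.≤⇒≯ (𝐦-mono-≤ (ℕ.≮⇒≥ i≮j)))

  𝐦-next-< : ∀ {i i⁺} → ⟦ i⁺ ⟧ ≡ ⟦ i ⟧ ℕ.+ 1 → 𝐦 f i < 𝐦 f i⁺
  𝐦-next-< {i} i⁺≡ = 𝐦-mono-< (ℕ.≤-reflexive (ℕ.suc-injective (trans (ℕ.+-comm 1 ⟦ i ⟧) (sym i⁺≡))))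

  𝐦-next-gap : ∀ {i i⁺} → ⟦ i⁺ ⟧ ≡ ⟦ i ⟧ ℕ.+ 1 → ∀ j → 𝐦 f i < f at j → 𝐦 f i⁺ ≤ f at j
  𝐦-next-gap {i} {i⁺} i⁺≡ j mi<fj with index (j , refl)
  ... | k , mk≡fj = subst (𝐦 f i⁺ ≤_) mk≡fj (𝐦-mono-≤ (ℕ.s≤s⁻¹
        (ℕ.≤-trans (ℕ.≤-reflexive (trans i⁺≡ (ℕ.+-comm ⟦ i ⟧ 1)))
          (s≤s (𝐦-cancel-< (subst (𝐦 f i <_) (sym mk≡fj) mi<fj))))))

  -- The first position can only carry itself, so the image starts with zero and a positive value
  -- has a later index.
  0<𝐦⇒2≤ : ∀ {i} → 0 ℕ.< toℕ (𝐦 f i) → 2 ℕ.≤ ⟦ i ⟧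
  0<𝐦⇒2≤ {i} 0<mi with index-below (𝐦 f i) {0} z≤n
  ... | o , o≡0 with index (o , at-zero o o≡0)
  ...   | k , mk≡o = s≤s (ℕ.≤-<-trans z≤n (𝐦-cancel-<
          (subst (ℕ._< _) (sym (trans (cong toℕ mk≡o) o≡0)) 0<mi)))

  preimage⁺ : ∀ {x v} → ⟦ f at x ⟧ ≡ v → x ∈ₛ f ⁻¹ v
  preimage⁺ {x} {v} fx≡v =
    lookup⇒[]= x _ (trans (lookup∘tabulate _ x) (dec-true (⟦ f at x ⟧ ℕ.≟ v) fx≡v))

  preimage⁻ : ∀ {x v} → x ∈ₛ f ⁻¹ v → ⟦ f at x ⟧ ≡ v
  preimage⁻ {x} {v} x∈ = go (⟦ f at x ⟧ ℕ.≟ v) (trans (sym (lookup∘tabulate _ x)) ([]=⇒lookup x∈))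
    where
    go : ∀ {P : Set} (P? : Dec P) → does P? ≡ true → P
    go (yes p) _ = p

  -- In the paper's numbering: f⁻¹(1) = {1, 2}.
  ZeroPair : Set
  ZeroPair = ∀ x → (toℕ (f at x) ≡ 0 → toℕ x ℕ.≤ 1) × (toℕ x ℕ.≤ 1 → toℕ (f at x) ≡ 0)

  ZeroPair⇒≡ : ZeroPair → ∀ {one two} → ⟦ one ⟧ ≡ 1 → ⟦ two ⟧ ≡ 2 → f ⁻¹ 1 ≡ ⁅ one ⁆ ∪ ⁅ two ⁆
  ZeroPair⇒≡ zp one≡ two≡ = ⊆-antisym
    (λ {x} x∈ → pair⁺ one≡ two≡ (proj₁ (zp x) (ℕ.suc-injective (preimage⁻ x∈))))
    (λ {x} x∈ → preimage⁺ (cong ℕ.suc (proj₂ (zp x) (pair⁻ one≡ two≡ x∈))))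

  ≡⇒ZeroPair : ∀ {one two} → ⟦ one ⟧ ≡ 1 → ⟦ two ⟧ ≡ 2 → f ⁻¹ 1 ≡ ⁅ one ⁆ ∪ ⁅ two ⁆ → ZeroPair
  ≡⇒ZeroPair one≡ two≡ eq x =
    (λ fx≡0 → pair⁻ one≡ two≡ (subst (x ∈ₛ_) eq (preimage⁺ (cong ℕ.suc fx≡0)))) ,
    (λ x≤1 → ℕ.suc-injective (preimage⁻ (subst (x ∈ₛ_) (sym eq) (pair⁺ one≡ two≡ x≤1))))

-- The cases of Ψ

module _ (f : SEF n) where

  -- In the paper's numbering: if 2 is not fixed then f(1) = f(2) = 1, and a third preimage of 1
  -- would put f in the realm of ♠.
  moved⇒ZeroPair : ∀ {one} → toℕ one ≡ 1 → f at one ≢ one → ¬ 3 ℕ.≤ ∣ f ⁻¹ 1 ∣ → ZeroPair f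
  moved⇒ZeroPair {one} one≡1 f1≢1 ¬3≤ x = to , from x
    where
    from : ∀ x → toℕ x ℕ.≤ 1 → toℕ (f at x) ≡ 0
    from x x≤1 with x ≟ one
    ... | yes refl = ℕ.n<1⇒n≡0 (subst (toℕ (f at x) ℕ.<_) one≡1 (moved-< f f1≢1))
    ... | no  x≢1  = trans (cong toℕ (at-zero f x x≡0)) x≡0
      where
      x≡0 : toℕ x ≡ 0
      x≡0 = ℕ.n<1⇒n≡0 (ℕ.≤∧≢⇒< x≤1 (λ x≡1 → x≢1 (toℕ-injective (trans x≡1 (sym one≡1)))))

    to : toℕ (f at x) ≡ 0 → toℕ x ℕ.≤ 1
    to fx≡0 with toℕ x ℕ.≤? 1
    ... | yes x≤1 = x≤1
    ... | no  x≰1 with index-below one {0} z≤n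
    ...   | o , o≡0 = contradiction
            (distinct⇒3≤∣p∣ {a = o} {one} {x}
              (preimage⁺ f (cong ℕ.suc (from o (ℕ.≤-trans (ℕ.≤-reflexive o≡0) z≤n))))
              (preimage⁺ f (cong ℕ.suc (from one (ℕ.≤-reflexive one≡1))))
              (preimage⁺ f (cong ℕ.suc fx≡0))
              (λ {refl → ℕ.1+n≢0 (trans (sym one≡1) o≡0)})
              (λ {refl → x≰1 (ℕ.≤-trans (ℕ.≤-reflexive o≡0) z≤n)})
              (λ {refl → x≰1 (ℕ.≤-reflexive one≡1)}))
            ¬3≤

  -- All of `⊛` holds: `w` is the next position, `x` makes the inclusion proper, and `v` shows that
  -- a larger image value exists. Whether the next image value is fixed decides between `◇` and `♣`.
  crowded⇒Case : ∀ {i v w x} → 0 ℕ.< toℕ (𝐦 f i) → f at 𝐦 f i ≢ 𝐦 f i → InImage f v → 𝐦 f i < v →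
                 ZeroPair f → toℕ w ≡ ℕ.suc (toℕ (𝐦 f i)) → f at w ≡ 𝐦 f i →
                 x ≢ w → f at x ≡ 𝐦 f i → Case f i
  crowded⇒Case {i} {v} {w} {x} 0<mi fmi≢mi im mi<v zp w≡ fw≡ x≢w fx≡
    with index f im
  ... | k , refl with index-below k (𝐦-cancel-< f mi<v)
  ...   | i⁺ , i⁺≡ = from-⊛ (f at 𝐦 f i⁺ ≟ 𝐦 f i⁺)
    where
    two : ∃ λ (two : Fin n) → toℕ two ≡ 1
    two = index-below (𝐦 f i) 0<mi

    one : ∃ λ (one : Fin n) → toℕ one ≡ 0
    one = index-below (𝐦 f i) z≤n

    ℓ-th : ∃ λ last → ⟦ last ⟧ ≡ ℓ f
    ℓ-th = last-index k

    mi<last : 𝐦 f i < 𝐦 f (proj₁ ℓ-th)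
    mi<last = ℕ.<-≤-trans mi<v (𝐦-mono-≤ f
      (ℕ.s≤s⁻¹ (ℕ.≤-trans (toℕ<n k) (ℕ.≤-reflexive (sym (proj₂ ℓ-th))))))

    star : ⊛ f i
    star = moved-< f fmi≢mi
      , (proj₁ ℓ-th , proj₂ ℓ-th , mi<last)
      , (proj₁ one , proj₁ two , cong ℕ.suc (proj₂ one) , cong ℕ.suc (proj₂ two) ,
         ZeroPair⇒≡ f zp (cong ℕ.suc (proj₂ one)) (cong ℕ.suc (proj₂ two)))
      , (w , trans (cong ℕ.suc w≡) (ℕ.+-comm 1 _) ,
         (λ {y} y∈ → preimage⁺ f (cong ⟦_⟧ (trans (cong (f at_) (x∈⁅y⁆⇒x≡y w y∈)) fw≡))) ,
         x , preimage⁺ f (cong ⟦_⟧ fx≡) , x≢y⇒x∉⁅y⁆ x≢w)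

    next≡ : ⟦ i⁺ ⟧ ≡ ⟦ i ⟧ ℕ.+ 1
    next≡ = trans (cong ℕ.suc i⁺≡) (ℕ.+-comm 1 _)

    from-⊛ : Dec (f at 𝐦 f i⁺ ≡ 𝐦 f i⁺) → Case f i
    from-⊛ (yes eq) = inj₂ (inj₂ (inj₁ (star , i⁺ , next≡ , eq)))
    from-⊛ (no neq) = inj₂ (inj₂ (inj₂ (star , i⁺ , next≡ , moved-< f neq)))

  -- Induction on the value v = f(x): position v + 1 carries a value ≤ v that no smaller
  -- value claims, hence v itself; any other position with value v would make v crowded.
  no-case⇒quiet : ∀ {p} → InImage f p → (∀ x → 0 ℕ.< toℕ x → x ≤ p → f at x ≢ x) →
                  (0 ℕ.< toℕ p → ZeroPair f) →
                  (∀ i → 2 ℕ.≤ ⟦ i ⟧ → 𝐦 f i < p → ¬ Case f i) →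
                  ∀ x → 0 ℕ.< toℕ x → f at x < p → toℕ x ≡ ℕ.suc (toℕ (f at x))
  no-case⇒quiet {p} im moves zp no-case x = go x (<-wellFounded (f at x))
    where
    go : ∀ x → Acc _<_ (f at x) → 0 ℕ.< toℕ x → f at x < p → toℕ x ≡ ℕ.suc (toℕ (f at x))
    go x (acc smaller) 0<x fx<p with toℕ (f at x) ℕ.≟ 0
    ... | yes fx≡0 = trans (ℕ.≤-antisym (proj₁ (zp (ℕ.≤-<-trans z≤n fx<p) x) fx≡0) 0<x)
                       (cong ℕ.suc (sym fx≡0))
    ... | no fx≢0 with index-below p fx<p | index f (x , refl)
    ...   | w , w≡ | i , mi≡fx with x ≟ w
    ...     | yes refl = w≡
    ...     | no  x≢w  = contradiction
              (crowded⇒Case {i} {p} {w} {x} 0<mi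
                (subst (λ m → f at m ≢ m) (sym mi≡fx)
                  (moves (f at x) (ℕ.n≢0⇒n>0 fx≢0) (ℕ.<⇒≤ fx<p)))
                im mi<p (zp (ℕ.≤-<-trans z≤n fx<p))
                (trans w≡ (cong (ℕ.suc ∘ toℕ) (sym mi≡fx))) (trans fw≡fx (sym mi≡fx)) x≢w (sym mi≡fx))
              (no-case i (0<𝐦⇒2≤ f 0<mi) mi<p)
      where
      mi<p : 𝐦 f i < p
      mi<p = subst (_< p) (sym mi≡fx) fx<p

      0<mi : 0 ℕ.< toℕ (𝐦 f i)
      0<mi = subst (λ m → 0 ℕ.< toℕ m) (sym mi≡fx) (ℕ.n≢0⇒n>0 fx≢0)

      0<w : 0 ℕ.< toℕ w
      0<w = subst (0 ℕ.<_) (sym w≡) ℕ.z<s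

      w≤p : w ≤ p
      w≤p = subst (ℕ._≤ toℕ p) (sym w≡) fx<p

      fw≤fx : f at w ≤ f at x
      fw≤fx = ℕ.s≤s⁻¹ (subst (toℕ (f at w) ℕ.<_) w≡ (moved-< f (moves w 0<w w≤p)))

      fw≡fx : f at w ≡ f at x
      fw≡fx with f at w ≟ f at x
      ... | yes eq = eq
      ... | no neq = toℕ-injective (ℕ.suc-injective (trans
            (sym (go w (smaller fw<fx) 0<w (ℕ.<-trans fw<fx fx<p))) w≡))
        where
        fw<fx : f at w < f at x
        fw<fx = ℕ.≤∧≢⇒< fw≤fx (neq ∘ toℕ-injective)

-- Each case of the map toggles at a pivot.

module _ (f : SEF n) where

  update-toggle : ∀ {p c v} (v≤c : v ≤ c) → (f at c ≡ c × v ≡ p) ⊎ (f at c ≡ p × v ≡ c) →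
                  Toggle p c f (f [ c ↦ v ]⟨ v≤c ⟩)
  update-toggle {c = c} {v} v≤c values = toggle
    (λ j j≢c → sym (lookup∘update′ j≢c (word f) v))
    ([ (λ (fc , v≡) → inj₁ (fc , trans (lookup∘update c (word f) v) v≡))
    , (λ (fc , v≡) → inj₂ (fc , trans (lookup∘update c (word f) v) v≡)) ]′ values)

  module _ (df : DF f) {i : Fin (ℓ f)} (2≤i : 2 ℕ.≤ ⟦ i ⟧)
           (none : ∀ j → j < i → ¬ (2 ℕ.≤ ⟦ j ⟧ × Case f j)) where

    private
      no-case : ∀ j → 2 ℕ.≤ ⟦ j ⟧ → 𝐦 f j < 𝐦 f i → ¬ Case f j
      no-case j 2≤j mj<mi case = none j (𝐦-cancel-< f mj<mi) (2≤j , case)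

      moves : ∀ x → 0 ℕ.< toℕ x → x < 𝐦 f i → f at x ≢ x
      moves x 0<x x<mi fx≡x with index f (x , fx≡x)
      ... | j , refl = no-case j (0<𝐦⇒2≤ f 0<x) x<mi (inj₁ fx≡x)

      h : Fin (ℓ f)
      h = pred i

      p : Fin n
      p = 𝐦 f h

      i≡h+1 : ⟦ i ⟧ ≡ ⟦ h ⟧ ℕ.+ 1
      i≡h+1 = suc-pred i 2≤i

      p<m : p < 𝐦 f i
      p<m = 𝐦-next-< f i≡h+1

    -- Minimality of `i` excludes `♥` at earlier indices, so every positive position below `𝐦 f i`
    -- is moved, which is what `p-moves` and `quiet` rest on.
    ♥-pivot : ♥ f i → Pivot f p (𝐦 f i)
    ♥-pivot fm≡m = record
      { p<c     = p<m
      ; gap     = 𝐦-next-gap f i≡h+1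
      ; at-c    = inj₁ fm≡m
      ; p-hit   = p-hit
      ; c-hit   = df _ fm≡m
      ; p-moves = λ 0<p → moves p 0<p p<m
      ; quiet   = no-case⇒quiet f (image-𝐦 f h)
                    (λ x 0<x x≤p → moves x 0<x (ℕ.≤-<-trans x≤p p<m)) zeroPair
                    (λ j 2≤j mj<p → no-case j 2≤j (ℕ.<-trans mj<p p<m))
      }
      where
      p-hit : ∃ λ j → p < j × j ≢ 𝐦 f i × f at j ≡ p
      p-hit with later-hit f df (image-𝐦 f h)
      ... | j , p<j , fj≡p = j , p<j , (λ {refl → <⇒≢ p<m (trans (sym fj≡p) fm≡m)}) , fj≡p

      -- For positive `p` the index `h` is in range, so minimality rules out `♠` at `h` and thereby
      -- a third preimage of the least value.
      zeroPair : 0 ℕ.< toℕ p → ZeroPair f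
      zeroPair 0<p with index-below p 0<p
      ... | one , one≡1 = moved⇒ZeroPair f one≡1
            (moves one (subst (0 ℕ.<_) (sym one≡1) ℕ.z<s)
              (ℕ.≤-<-trans (subst (ℕ._≤ toℕ p) (sym one≡1) 0<p) p<m))
            (λ 3≤ → no-case h (0<𝐦⇒2≤ f 0<p) p<m (inj₂ (inj₁ (moved-< f (moves p 0<p p<m) , 3≤))))

    -- The size of `f ⁻¹ 1` does not depend on the index. If `p` were positive, it would be moved
    -- and `♠` would already hold at `h`. So `p` is zero, and `p-moves` and `quiet` hold vacuously.
    ♠-pivot : ♠ f i → Pivot f p (𝐦 f i) × f at 𝐦 f i ≡ p
    ♠-pivot (fm<m , 3≤) = record
      { p<c     = p<m
      ; gap     = 𝐦-next-gap f i≡h+1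
      ; at-c    = inj₂ fm≡p
      ; p-hit   = p-hit
      ; c-hit   = later-hit f df (image-𝐦 f i)
      ; p-moves = λ 0<p → contradiction (sym p≡0) (ℕ.<⇒≢ 0<p)
      ; quiet   = λ j _ fj<p → contradiction (subst (toℕ (f at j) ℕ.<_) p≡0 fj<p) (λ ())
      } , fm≡p
      where
      p≡0 : toℕ p ≡ 0
      p≡0 with toℕ p ℕ.≟ 0
      ... | yes p≡0 = p≡0
      ... | no  p≢0 = contradiction (inj₂ (inj₁ (moved-< f (moves p (ℕ.n≢0⇒n>0 p≢0) p<m) , 3≤)))
                        (no-case h (0<𝐦⇒2≤ f (ℕ.n≢0⇒n>0 p≢0)) p<m)

      fm≡p : f at 𝐦 f i ≡ p
      fm≡p = toℕ-injective (trans (ℕ.n≤0⇒n≡0 (subst (toℕ (f at 𝐦 f i) ℕ.≤_) p≡0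
        (ℕ.≮⇒≥ (λ p<fm → ℕ.<⇒≱ fm<m (𝐦-next-gap f i≡h+1 _ p<fm))))) (sym p≡0))

      p-hit : ∃ λ j → p < j × j ≢ 𝐦 f i × f at j ≡ p
      p-hit with 3≤∣p∣⇒third (f ⁻¹ 1) 3≤ p (𝐦 f i)
      ... | j , j∈ , j≢p , j≢m = j ,
            subst (ℕ._< toℕ j) (sym p≡0) (ℕ.n≢0⇒n>0 λ j≡0 → j≢p (toℕ-injective (trans j≡0 (sym p≡0)))) ,
            j≢m , toℕ-injective (trans (ℕ.suc-injective (preimage⁻ f j∈)) (sym p≡0))

    module _ (star : ⊛ f i) {i⁺ : Fin (ℓ f)} (i⁺≡ : ⟦ i⁺ ⟧ ≡ ⟦ i ⟧ ℕ.+ 1) where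

      private
        m c : Fin n
        m = 𝐦 f i
        c = 𝐦 f i⁺

        fm<m : f at m < m
        fm<m = proj₁ star

        beyond-m : ∀ {j} → f at j ≡ m → m < j
        beyond-m {j} fj≡m = ℕ.≤∧≢⇒< (subst (_≤ j) fj≡m (at-≤ f j)) λ m≡j →
          <⇒≢ fm<m (trans (cong (f at_) (toℕ-injective m≡j)) fj≡m)

        -- The proper inclusion in `⊛` provides two occurrences `w` and `x` of `m`, at most one of
        -- which is `c`.
        m-hit : ∃ λ j → m < j × j ≢ c × f at j ≡ m
        m-hit with proj₂ (proj₂ (proj₂ star))
        ... | w , _ , w⊆ , x , x∈ , x∉w with w ≟ c
        ...   | no w≢c = w , beyond-m fw≡m , w≢c , fw≡m
          where
          fw≡m : f at w ≡ m
          fw≡m = toℕ-injective (ℕ.suc-injective (preimage⁻ f (w⊆ (x∈⁅x⁆ w))))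
        ...   | yes refl = x , beyond-m fx≡m , (λ {refl → x∉w (x∈⁅x⁆ x)}) , fx≡m
          where
          fx≡m : f at x ≡ m
          fx≡m = toℕ-injective (ℕ.suc-injective (preimage⁻ f x∈))

        zeroPair : ZeroPair f
        zeroPair with proj₁ (proj₂ (proj₂ star))
        ... | _ , _ , one≡ , two≡ , eq = ≡⇒ZeroPair f one≡ two≡ eq

        quiet : ∀ j → 0 ℕ.< toℕ j → f at j < m → toℕ j ≡ ℕ.suc (toℕ (f at j))
        quiet = no-case⇒quiet f (image-𝐦 f i) moves-≤ (λ _ → zeroPair) no-case
          where
          moves-≤ : ∀ x → 0 ℕ.< toℕ x → x ≤ m → f at x ≢ x
          moves-≤ x 0<x x≤m with x ≟ m
          ... | yes refl = <⇒≢ fm<m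
          ... | no  x≢m  = moves x 0<x (ℕ.≤∧≢⇒< x≤m (x≢m ∘ toℕ-injective))

      -- By the gap the letter at `c` is at most `m`. Were it smaller, `quiet` would place `c` at or
      -- below `m`.
      ♣-drop : f at c < c → f at c ≡ m
      ♣-drop fc<c with f at c ≟ m
      ... | yes fc≡m = fc≡m
      ... | no  fc≢m = contradiction
            (subst (ℕ._≤ toℕ m) (sym (quiet c (ℕ.≤-<-trans z≤n (𝐦-next-< f i⁺≡)) fc<m)) fc<m)
            (ℕ.<⇒≱ (𝐦-next-< f i⁺≡))
        where
        fc<m : f at c < m
        fc<m = ℕ.≤∧≢⇒< (ℕ.≮⇒≥ (λ m<fc → ℕ.<⇒≱ fc<c (𝐦-next-gap f i⁺≡ c m<fc)))
                 (fc≢m ∘ toℕ-injective)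

      -- In cases `◇` and `♣` the pivot sits one index further on: its lower value is `𝐦 f i`
      -- itself, which `⊛` makes moved and repeated.
      ⊛-pivot : f at c ≡ c ⊎ f at c ≡ m → Pivot f m c
      ⊛-pivot at-c = record
        { p<c     = 𝐦-next-< f i⁺≡
        ; gap     = 𝐦-next-gap f i⁺≡
        ; at-c    = at-c
        ; p-hit   = m-hit
        ; c-hit   = later-hit f df (image-𝐦 f i⁺)
        ; p-moves = λ _ → <⇒≢ fm<m
        ; quiet   = quiet
        }

    act-toggles : (case : Case f i) → ∃₂ λ p c → Pivot f p c × Toggle p c f (act f i case)
    act-toggles (inj₁ fm≡m) = _ , _ , ♥-pivot fm≡m , update-toggle (𝐦-pred-≤ f i) (inj₁ (fm≡m , refl))
    act-toggles (inj₂ (inj₁ spade)) =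
      _ , _ , proj₁ (♠-pivot spade) , update-toggle ℕ.≤-refl (inj₂ (proj₂ (♠-pivot spade) , refl))
    act-toggles (inj₂ (inj₂ (inj₁ (star , i⁺ , i⁺≡ , fc≡c)))) =
      _ , _ , ⊛-pivot star i⁺≡ (inj₁ fc≡c) ,
      update-toggle (𝐦-pred-≤ f i⁺) (inj₁ (fc≡c , cong (𝐦 f) pred-i⁺))
      where
      -- `unfix` at `i⁺` writes `𝐦 f (pred i⁺)`, which has to be recognised as the lower value
      -- `𝐦 f i`.
      pred-i⁺ : pred i⁺ ≡ i
      pred-i⁺ = toℕ-injective (ℕ.suc-injective (ℕ.+-cancelʳ-≡ 1 _ _
        (trans (sym (suc-pred i⁺ (subst (2 ℕ.≤_) (sym i⁺≡) (ℕ.m≤n⇒m≤n+o 1 2≤i)))) i⁺≡)))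
    act-toggles (inj₂ (inj₂ (inj₂ (star , i⁺ , i⁺≡ , fc<c)))) =
      _ , _ , ⊛-pivot star i⁺≡ (inj₂ fc≡m) , update-toggle ℕ.≤-refl (inj₂ (fc≡m , refl))
      where
      fc≡m : f at 𝐦 f i⁺ ≡ 𝐦 f i
      fc≡m = ♣-drop star i⁺≡ fc<c

  Eligible : Fin (ℓ f) → Set
  Eligible i = 2 ℕ.≤ ⟦ i ⟧ × Case f i

  leastCase : ∃ Eligible → ∃ (LeastCase f)
  leastCase (i , e) = go i (<-wellFounded i) e
    where
    go : ∀ i → Acc _<_ i → Eligible i → ∃ (LeastCase f)
    go i (acc smaller) e with any? (λ j → (j <? i) ×-dec ((2 ℕ.≤? ⟦ j ⟧) ×-dec case? f j))
    ... | yes (j , j<i , e′) = go j (smaller j<i) e′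
    ... | no none = i , e , λ j j<i e′ → none (j , j<i , e′)

  -- Without a case, only the first position is fixed. For the greatest image value `p`,
  -- `no-case⇒quiet` puts each smaller letter after the first position one step beyond its own
  -- value, and all other letters are `p`. This is the matchless word with parameter `p`; `x₀`
  -- witnesses that the image is nonempty.
  no-case⇒matchless : DF f → Fin n → ¬ ∃ Eligible → Matchless f
  no-case⇒matchless df x₀ none = p , p<n , λ j → first j , word≡ j
    where
    moves : ∀ x → 0 ℕ.< toℕ x → f at x ≢ x
    moves x 0<x fx≡x with index f (x , fx≡x)
    ... | j , refl = none (j , 0<𝐦⇒2≤ f 0<x , inj₁ fx≡x)

    top : ∃ λ last → ⟦ last ⟧ ≡ ℓ f
    top = last-index (proj₁ (index f (x₀ , refl)))

    p : Fin n
    p = 𝐦 f (proj₁ top)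

    p-max : ∀ j → f at j ≤ p
    p-max j with index f (j , refl)
    ... | k , mk≡fj = subst (_≤ p) mk≡fj (𝐦-mono-≤ f
          (ℕ.s≤s⁻¹ (ℕ.≤-trans (toℕ<n k) (ℕ.≤-reflexive (sym (proj₂ top))))))

    p<n : ⟦ p ⟧ ℕ.< n
    p<n with later-hit f df (image-𝐦 f (proj₁ top))
    ... | j , p<j , _ = ℕ.≤-<-trans p<j (toℕ<n j)

    zeroPair : 0 ℕ.< toℕ p → ZeroPair f
    zeroPair 0<p with index-below p 0<p
    ... | one , one≡1 = moved⇒ZeroPair f one≡1 (moves one (subst (0 ℕ.<_) (sym one≡1) ℕ.z<s))
          (λ 3≤ → none (proj₁ top , 0<𝐦⇒2≤ f 0<p , inj₂ (inj₁ (moved-< f (moves p 0<p) , 3≤))))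

    quiet : ∀ x → 0 ℕ.< toℕ x → f at x < p → toℕ x ≡ ℕ.suc (toℕ (f at x))
    quiet = no-case⇒quiet f (image-𝐦 f (proj₁ top)) (λ x 0<x _ → moves x 0<x) zeroPair
              (λ i 2≤i _ case → none (i , 2≤i , case))

    first : ∀ j → ⟦ j ⟧ ≡ 1 → ⟦ f at j ⟧ ≡ 1
    first j j≡1 = trans (cong ⟦_⟧ (at-zero f j (ℕ.suc-injective j≡1))) j≡1

    word≡ : ∀ j → 2 ℕ.≤ ⟦ j ⟧ → ⟦ f at j ⟧ ≡ (⟦ j ⟧ ∸ 1) ⊓ ⟦ p ⟧
    word≡ j (s≤s 0<j) with f at j ≟ p
    ... | no fj≢p = trans (sym (quiet j 0<j fj<p))
          (sym (ℕ.m≤n⇒m⊓n≡m (ℕ.≤-trans (ℕ.≤-reflexive (quiet j 0<j fj<p)) (ℕ.m≤n⇒m≤1+n fj<p))))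
      where
      fj<p : f at j < p
      fj<p = ℕ.≤∧≢⇒< (p-max j) (fj≢p ∘ toℕ-injective)
    -- Being moved, `j` lies beyond its letter `p`, so the minimum is `⟦ p ⟧`.
    ... | yes fj≡p = trans (cong ⟦_⟧ fj≡p) (sym (ℕ.m≥n⇒m⊓n≡n
          (subst (_< j) fj≡p (moved-< f (moves j 0<j)))))

-- The map on words of derangements, and transfer to permutations.

Ψ-matchless : (f : SEF n) → Matchless f → Ψ f ≡ f
Ψ-matchless f ml with matchless? f
... | yes _  = refl
... | no ¬ml = contradiction ml ¬ml

-- The default clause of `Ψ` is never reached here: without an eligible index the word would be
-- matchless.
Ψ-toggles : (f : SEF n) → Fin n → DF f → ¬ Matchless f →
            ∃₂ λ p c → Pivot f p c × Toggle p c f (Ψ f)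
Ψ-toggles f x₀ df ¬ml with matchless? f
... | yes ml = contradiction ml ¬ml
... | no _ with any? (leastCase? f)
...   | yes (i , (2≤i , case) , none) = act-toggles f df 2≤i none case
...   | no none = contradiction (no-case⇒matchless f df x₀ (none ∘ leastCase f)) ¬ml

EXCv-resp : {σ τ : Permutation′ n} → σ ≈ τ → ∀ {v} → EXCv σ v → EXCv τ v
EXCv-resp σ≈τ (j , σj≡v , j<σj) = j , trans (sym (σ≈τ j)) σj≡v , subst (j <_) (σ≈τ j) j<σj

RLMv-resp : {σ τ : Permutation′ n} → σ ≈ τ → ∀ {v} → RLMv σ v → RLMv τ v
RLMv-resp σ≈τ (i , σi≡v , min) =
  i , trans (sym (σ≈τ i)) σi≡v , λ j i<j → subst₂ _<_ (σ≈τ i) (σ≈τ j) (min j i<j)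

module _ (x₀ : Fin n) (f : SEF n) (df : DF f) where

  Ψ-cases : (Ψ f ≡ f) ⊎ (∃₂ λ p c → Pivot f p c × Toggle p c f (Ψ f))
  Ψ-cases = cases (matchless? f)
    where
    cases : Dec (Matchless f) → _
    cases (yes ml) = inj₁ (Ψ-matchless f ml)
    cases (no ¬ml) = inj₂ (Ψ-toggles f x₀ df ¬ml)

  -- One direction of `step` suffices, because the reversed toggle is again a toggle and the pivot
  -- survives it.
  Ψ-invariant : (I : SEF n → Set) →
                (∀ {p c f g} → Toggle p c f g → Pivot f p c → I f → I g) →
                (I f → I (Ψ f)) × (I (Ψ f) → I f)
  Ψ-invariant I step with Ψ-cases
  ... | inj₁ eq = subst I (sym eq) , subst I eq
  ... | inj₂ (_ , _ , piv , tog) =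
        step tog piv , step (toggle-sym tog) (toggle-pivot tog piv)

  Ψ-DF : DF (Ψ f)
  Ψ-DF = proj₁ (Ψ-invariant DF toggle-DF) df

  Ψ-image : ∀ {v} → (InImage f v → InImage (Ψ f) v) × (InImage (Ψ f) v → InImage f v)
  Ψ-image {v} = Ψ-invariant (λ h → InImage h v) (λ tog piv → toggle-image tog piv)

  Ψ-WordMin : ∀ {v} → (WordMin f v → WordMin (Ψ f) v) × (WordMin (Ψ f) v → WordMin f v)
  Ψ-WordMin {v} = Ψ-invariant (λ h → WordMin h v) (λ tog piv → toggle-WordMin tog piv)

  Ψ-sgn : ¬ Matchless f → sgn (sefToPerm (Ψ f)) ≡ - sgn (sefToPerm f)
  Ψ-sgn ¬ml with Ψ-toggles f x₀ df ¬ml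
  ... | p , c , piv , toggle agree (inj₁ (fc≡c , gc≡p)) =
        sgn-unfix f (Ψ f) agree fc≡c (λ gc≡c → <⇒≢ (Pivot.p<c piv) (trans (sym gc≡p) gc≡c))
  -- `sgn-unfix` leads from the fixed letter to the moved one, so it is applied from `Ψ f` back to
  -- `f`.
  ... | p , c , piv , toggle agree (inj₂ (fc≡p , gc≡c)) = trans (sym (neg-involutive _)) (cong -_ (sym
        (sgn-unfix (Ψ f) f (λ j j≢c → sym (agree j j≢c)) gc≡c
          (λ fc≡c → <⇒≢ (Pivot.p<c piv) (trans (sym fc≡p) fc≡c)))))

-- The surviving pivot shows that `Ψ f` is not matchless, so `Ψ` toggles it at some pivot. By
-- uniqueness this is the same one, and toggling twice restores the letter.
Ψ-involutive : (x₀ : Fin n) (f : SEF n) → DF f → Ψ (Ψ f) ≡ f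
Ψ-involutive x₀ f df with Ψ-cases x₀ f df
... | inj₁ eq = trans (cong Ψ eq) eq
... | inj₂ (p , c , piv , tog) = back (Ψ-toggles (Ψ f) x₀ (Ψ-DF x₀ f df) (pivot⇒¬matchless piv′))
  where
  piv′ : Pivot (Ψ f) p c
  piv′ = toggle-pivot tog piv

  back : (∃₂ λ p c → Pivot (Ψ f) p c × Toggle p c (Ψ f) (Ψ (Ψ f))) → Ψ (Ψ f) ≡ f
  back (p″ , c″ , piv″ , tog″) with pivot-unique piv′ piv″
  ... | refl , refl = sym (toggle-twice (<⇒≢ (Pivot.p<c piv)) tog tog″)

corollary20 : (n : ℕ) → n ≥ 1 →
    (∀ (σ : Permutation′ n) → IsDerangement σ → IsDerangement (Ψ̂ σ))
    × (∀ (σ : Permutation′ n) → IsDerangement σ → Ψ̂ (Ψ̂ σ) ≈ σ)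
    × (∀ (σ : Permutation′ n) → IsDerangement σ → EXCv (Ψ̂ σ) ≐ EXCv σ)
    × (∀ (σ : Permutation′ n) → IsDerangement σ → RLMv (Ψ̂ σ) ≐ RLMv σ)
    × (∀ (σ : Permutation′ n) → IsDerangement* σ → sgn (Ψ̂ σ) ≡ - sgn σ)
corollary20 n n≥1 =
    (λ σ der → DF⇒derangement (Ψ (word-of σ)) (Ψ-DF x₀ (word-of σ) (df σ der)))
  -- The second application starts from the word of `sefToPerm (Ψ (word-of σ))`, which is
  -- `Ψ (word-of σ)` by injectivity of `sefToPerm`.
  , (λ σ der i → trans
      (cong (λ f → sefToPerm (Ψ f) ⟨$⟩ʳ i) (sefToPerm⁻¹∘sefToPerm (Ψ (word-of σ))))
      (trans (cong (λ f → sefToPerm f ⟨$⟩ʳ i) (Ψ-involutive x₀ (word-of σ) (df σ der))) (≈σ σ i)))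
  -- Excedance values are the letters missed by the word, so each inclusion uses the image inclusion
  -- in the opposite direction.
  , (λ σ der →
      (λ exc → EXCv-resp {σ = sefToPerm (word-of σ)} {σ} (≈σ σ) (missed⇒excedance (word-of σ)
        (excedance⇒missed (Ψ (word-of σ)) exc ∘ proj₁ (Ψ-image x₀ (word-of σ) (df σ der))))) ,
      (λ exc → missed⇒excedance (Ψ (word-of σ)) (excedance⇒missed (word-of σ)
        (EXCv-resp {σ = σ} {sefToPerm (word-of σ)} (σ≈ σ) exc)
        ∘ proj₂ (Ψ-image x₀ (word-of σ) (df σ der)))))
  , (λ σ der →
      (λ min → RLMv-resp {σ = sefToPerm (word-of σ)} {σ} (≈σ σ) (WordMin⇒RLMv (word-of σ)
        (proj₂ (Ψ-WordMin x₀ (word-of σ) (df σ der)) (RLMv⇒WordMin (Ψ (word-of σ)) min)))) ,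
      (λ min → WordMin⇒RLMv (Ψ (word-of σ)) (proj₁ (Ψ-WordMin x₀ (word-of σ) (df σ der))
        (RLMv⇒WordMin (word-of σ) (RLMv-resp {σ = σ} {sefToPerm (word-of σ)} (σ≈ σ) min)))))
  , (λ σ (der , ¬ml) → trans (Ψ-sgn x₀ (word-of σ) (df σ der) ¬ml)
      (cong -_ (sgn-cong {σ = sefToPerm (word-of σ)} {σ} (≈σ σ))))
  where
  x₀ : Fin n
  x₀ = fromℕ< n≥1

  word-of : Permutation′ n → SEF n
  word-of = sefToPerm⁻¹

  ≈σ : (σ : Permutation′ n) → sefToPerm (word-of σ) ≈ σ
  ≈σ = sefToPerm∘sefToPerm⁻¹

  σ≈ : (σ : Permutation′ n) → σ ≈ sefToPerm (word-of σ)
  σ≈ σ i = sym (≈σ σ i)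

  df : (σ : Permutation′ n) → IsDerangement σ → DF (word-of σ)
  df σ der = derangement⇒DF (word-of σ) (λ i eq → der i (trans (σ≈ σ i) eq))
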